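{- Let $k\geq 4$ be an integer and let $G$ be a finite simple graph with maximum degree $\Delta\geq k$. Then: (1) if $\mathrm{mad}(G)<\frac{12}{5}$, then $\chi^l_k(G)=\left\lceil\frac{\Delta}{k-1}\right\rceil+1$; (2) if $\mathrm{mad}(G)<\frac{8}{3}$, then $\chi^l_k(G)\leq\left\lceil\frac{\Delta}{k-1}\right\rceil+2$; (3) if $\mathrm{mad}(G)<3$, then $\chi^l_k(G)\leq\left\lceil\frac{\Delta}{k-1}\right\rceil+3$.
   Context: All graphs are finite, simple and undirected. The maximum average degree of $G$ is $\mathrm{mad}(G)=\max\{2|E(H)|/|V(H)| : H\subseteq G\}$. A $k$-forested coloring of $G$ is a proper vertex coloring such that, for any two color classes, the subgraph induced by the union of these two classes is a forest of maximum degree less than $k$. If $L$ assigns to each vertex $v$ a list $L(v)$ of colors, $G$ is $k$-forested $L$-colorable if it has a $k$-forested coloring in which each vertex $v$ receives a color from $L(v)$; $G$ is $k$-forested $q$-choosable if it is $k$-forested $L$-colorable for every list assignment $L$ with $|L(v)|=q$ for all $v$. The $k$-forested choice number $\chi^l_k(G)$ is the smallest $q$ such that $G$ is $k$-forested $q$-choosable. -}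

module Defs where

open import Data.Fin.Base using (Fin; zero; suc; fromℕ; inject₁)
import Data.Fin.Properties as Fin
open import Data.Fin.Subset using (Subset; inside; outside; _∈_; ∣_∣)
open import Data.Fin.Subset.Properties using (_∈?_)
open import Data.Integer.Base using (+_)
open import Data.List.Base using (List; []; _∷_; _++_; allFin; cartesianProduct; filter; length; lookup; map)
import Data.List.Extrema
import Data.List.Membership.Propositional as List
open import Data.List.Relation.Unary.Unique.Propositional using (Unique)
open import Data.Nat.Base using (ℕ; zero; suc; _+_; _*_; _≤_; _<_)
open import Data.Nat.DivMod using (_/_)
import Data.Nat.Properties as ℕ
open import Data.Product.Base using (Σ-syntax; _×_; _,_; proj₁; proj₂)
import Data.Rational.Base as ℚ
open ℚ using (ℚ; 0ℚ)
import Data.Rational.Properties as ℚ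
import Data.Vec.Base as Vec
open import Function.Definitions using (Injective)
open import Level using (0ℓ)
open import Relation.Binary.Bundles using (DecTotalOrder)
open import Relation.Binary.Core using (Rel)
open import Relation.Binary.Definitions using (Decidable; Irreflexive; Symmetric)
open import Relation.Binary.PropositionalEquality.Core using (_≡_; _≢_; refl)
open import Relation.Nullary.Decidable using (_×-dec_; _⊎-dec_; _→-dec_)
open import Relation.Nullary.Negation.Core using (¬_)

open Data.List.Extrema ℕ.≤-totalOrder using () renaming (max to maxℕ)
open Data.List.Extrema (DecTotalOrder.totalOrder ℚ.≤-decTotalOrder) using () renaming (max to maxℚ)

private
  variable
    n : ℕ

-- Division by 0 yields 0 in both operations below.

⌈_/_⌉ : ℕ → ℕ → ℕ
⌈ m / zero  ⌉ = 0
⌈ m / suc d ⌉ = (m + d) / suc d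

_÷_ : ℕ → ℕ → ℚ
m ÷ zero  = 0ℚ
m ÷ suc d = + m ℚ./ suc d

record Graph (n : ℕ) : Set₁ where
  infix 4 _~_ _~?_
  field
    _~_      : Rel (Fin n) 0ℓ
    ~-sym    : Symmetric _~_
    ~-irrefl : Irreflexive _≡_ _~_
    _~?_     : Decidable _~_

module _ (G : Graph n) where
  open Graph G

  degree : Fin n → ℕ
  degree v = length (filter (v ~?_) (allFin n))

  maxDegree : ℕ
  maxDegree = maxℕ 0 (map degree (allFin n))

  -- Each edge uv is listed once, as the pair with u < v.
  edges : List (Fin n × Fin n)
  edges = filter (λ (u , v) → (u Fin.<? v) ×-dec (u ~? v))
                 (cartesianProduct (allFin n) (allFin n))

  -- For a duplicate-free list vs, the subgraph induced by the vertices in vs,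
  -- renumbered by their positions in vs.
  induced : (vs : List (Fin n)) → Graph (length vs)
  induced vs = record
    { _~_      = λ i j → lookup vs i ~ lookup vs j
    ; ~-sym    = ~-sym
    ; ~-irrefl = λ { refl → ~-irrefl refl }
    ; _~?_     = λ i j → lookup vs i ~? lookup vs j
    }

  record Cycle : Set where
    field
      {m}       : ℕ
      vertex    : Fin (3 + m) → Fin n
      injective : Injective _≡_ _≡_ vertex
      step      : ∀ (i : Fin (2 + m)) → vertex (inject₁ i) ~ vertex (suc i)
      close     : vertex (fromℕ (2 + m)) ~ vertex zero

  Forest : Set
  Forest = ¬ Cycle

  -- A subgraph is a set W of vertices and a set F of edges (given by their
  -- positions in the list of edges) whose endpoints all lie in W.
  IsSubgraph : Subset n → Subset (length edges) → Set
  IsSubgraph W F =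
    ∀ e → e ∈ F → proj₁ (lookup edges e) ∈ W × proj₂ (lookup edges e) ∈ W

  isSubgraph? : Decidable IsSubgraph
  isSubgraph? W F = Fin.all? λ e →
    (e ∈? F) →-dec
    ((proj₁ (lookup edges e) ∈? W) ×-dec (proj₂ (lookup edges e) ∈? W))

allSubsets : ∀ n → List (Subset n)
allSubsets zero    = Vec.[] ∷ []
allSubsets (suc n) =
  map (outside Vec.∷_) (allSubsets n) ++ map (inside Vec.∷_) (allSubsets n)

-- The subgraph without vertices contributes 0; as average degrees are
-- nonnegative, this does not affect the maximum over the nonempty subgraphs.
mad : Graph n → ℚ
mad {n} G = maxℚ 0ℚ
  (map (λ (W , F) → (2 * ∣ F ∣) ÷ ∣ W ∣)
       (filter (λ (W , F) → isSubgraph? G W F)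
               (cartesianProduct (allSubsets n) (allSubsets (length (edges G))))))

module _ (k : ℕ) (G : Graph n) where
  open Graph G

  Proper : (Fin n → ℕ) → Set
  Proper c = ∀ {u v} → u ~ v → c u ≢ c v

  twoClasses : (Fin n → ℕ) → ℕ → ℕ → List (Fin n)
  twoClasses c a b = filter (λ v → (c v ℕ.≟ a) ⊎-dec (c v ℕ.≟ b)) (allFin n)

  IsForested : (Fin n → ℕ) → Set
  IsForested c = Proper c ×
    (∀ a b → a ≢ b →
      let H = induced G (twoClasses c a b) in Forest H × maxDegree H < k)

  ForestedColorable : (Fin n → List ℕ) → Set
  ForestedColorable L =
    Σ[ c ∈ (Fin n → ℕ) ] IsForested c × (∀ v → c v List.∈ L v)

  -- Lists of colours are sets, hence the uniqueness condition.
  ForestedChoosable : ℕ → Set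
  ForestedChoosable q = ∀ (L : Fin n → List ℕ) →
    (∀ v → Unique (L v)) → (∀ v → length (L v) ≡ q) → ForestedColorable L

  IsForestedChoiceNumber : ℕ → Set
  IsForestedChoiceNumber χ =
    ForestedChoosable χ × (∀ q → ForestedChoosable q → χ ≤ q)

{-# OPTIONS --safe #-}

-- Write t = k - 1 and M = ⌈Δ / t⌉.  Induced subgraphs of G are coloured by
-- induction on the number of vertices.  When a vertex v is coloured last, at most
-- M - 1 colours are saturated (used t times) around any given neighbour of v,
-- since one of its at most M t neighbours is v itself.  With lists of size M + 1,
-- M + 2, M + 3 this makes the following configurations reducible: a vertex of
-- degree at most 1; a 2-vertex with neighbours of degrees at most 2 and 3 (1);
-- a 2-vertex with a 2-neighbour, or with neighbours of degrees at most 3 and 5 (2);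
-- a 2-vertex with a neighbour of degree at most 3, a 4-vertex with three
-- 2-neighbours and a 5-vertex with four 2-neighbours (3).  Discharging produces
-- one of them from the bound on the average degree.  The lower bound in (1) comes
-- from giving all vertices the same list.  The choice numbers in (2) and (3) exist
-- constructively because choosability is decidable: colours can be renamed, so
-- that only finitely many list assignments matter.

module Submission where

open import Defs

open import Data.Bool.Base using (true; false; if_then_else_)
open import Data.Fin.Base using (Fin; zero; suc; fromℕ; fromℕ<; inject₁; toℕ)
import Data.Fin.Base as Fin
import Data.Fin.Properties as Fin
open import Data.Fin.Relation.Unary.Top using (view; ‵fromℕ; ‵inject₁; view-fromℕ; view-inject₁)
open import Data.Fin.Subset using (Subset; _-_; _─_; inside; outside; ⊤)
  renaming (_∈_ to _∈ˢ_; _∉_ to _∉ˢ_; ∣_∣ to size)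
open import Data.Fin.Subset.Properties
  using (x∈p∧x≢y⇒x∈p-y; x∈p⇒∣p-x∣<∣p∣; p⊆q⇒∣p∣≤∣q∣; p─q⊆p; x∈⁅x⁆; ∈⊤; nonempty?)
  renaming (_∈?_ to _∈ˢ?_)
import Data.Integer.Base as ℤ
import Data.Integer.Properties as ℤ
open import Data.List.Base
  using (List; []; _∷_; _++_; length; filter; map; cartesianProduct; cartesianProductWith; concat; allFin; upTo; lookup)
import Data.List.Base as List
import Data.List.Extrema
import Data.List.Membership.DecPropositional as DecMembership
open import Data.List.Membership.Propositional using (_∈_; _∉_; find)
open import Data.List.Membership.Propositional.Properties
open import Data.List.Properties
open import Data.List.Relation.Unary.All using (All; []; _∷_)
import Data.List.Relation.Unary.All as All
open import Data.List.Relation.Unary.All.Properties using (¬Any⇒All¬; all-filter)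
open import Data.List.Relation.Unary.AllPairs using ([]; _∷_)
import Data.List.Relation.Unary.AllPairs as AllPairs
open import Data.List.Relation.Unary.Any using (Any; here; there; any?)
import Data.List.Relation.Unary.Any as Any
open import Data.List.Relation.Unary.Any.Properties using (lookup-index)
import Data.List.Relation.Unary.Unique.DecPropositional as DecUnique
open import Data.List.Relation.Unary.Unique.Propositional using (Unique)
import Data.List.Relation.Unary.Unique.Propositional.Properties as Unique
open import Data.Nat.Base
open import Data.Nat.DivMod using (m≡m%n+[m/n]*n; m%n<n; m<n*o⇒m/o<n)
open import Data.Nat.Induction using (<-wellFounded)
open import Data.Nat.ListAction using (sum)
open import Data.Nat.Properties hiding (_≟_)
import Data.Nat.Properties as ℕ
open import Data.Nat.Solver using (module +-*-Solver)
open import Data.Product.Base using (Σ-syntax; ∃-syntax; _×_; _,_; proj₁; proj₂; swap)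
import Data.Rational.Base as ℚ
import Data.Rational.Properties as ℚ
import Data.Rational.Unnormalised.Base as ℚᵘ
import Data.Rational.Unnormalised.Properties as ℚᵘ
open import Data.Sum.Base using (_⊎_; inj₁; inj₂; [_,_]′)
import Data.Vec.Base as Vec
import Data.Vec.Functional as Vector
open import Data.Vec.Properties using (lookup⇒[]=; []=⇒lookup; lookup∘tabulate)
open import Function.Base
open import Induction.WellFounded using (Acc; acc)
open import Level using (0ℓ)
open import Relation.Binary.Bundles using (DecTotalOrder)
open import Relation.Binary.Definitions using (tri<; tri≈; tri>)
open import Relation.Binary.PropositionalEquality
open import Relation.Nullary
open import Relation.Nullary.Decidable using (dec-true; map′; _×-dec_; _⊎-dec_; _→-dec_)
open import Relation.Unary using (Pred; Decidable)

open Data.List.Extrema ≤-totalOrder using (argmax-sel) renaming (xs≤max to xs≤maxℕ; max≤v⁺ to maxℕ≤v⁺)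
open Data.List.Extrema (DecTotalOrder.totalOrder ℚ.≤-decTotalOrder) using () renaming (xs≤max to xs≤maxℚ)
open DecMembership ℕ._≟_ using () renaming (_∈?_ to _∈ℕ?_)
open DecUnique ℕ._≟_ using (unique?)

-- If colouring `v` closes a two-coloured cycle, the cycle runs through two neighbours of `v` that
-- share a colour. When the two neighbours of a 2-vertex differ in colour, their colours and the
-- saturated ones are all that must be avoided. When they agree, one colour fewer is forbidden by
-- them, and the remaining choices are spent on making one of the two a dead end for the new colour.
-- Each configuration is a count showing that this fits into the list.
--
-- The bound `k ≥ 4`, that is `t ≥ 3`, enters this count: once `v` is removed, a neighbour of degree
-- at most 3 has no saturated colour, and one of degree at most 6 has at most one.
--
-- The 4- and 5-vertices in (3) resist the removal of a single 2-neighbour, because avoiding every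
-- colour around the centre is too expensive. Hence the centre is recoloured as well, with a colour
-- that controls the far ends of its 2-neighbours.
--
-- Reducibility is not decided. Every vertex instead yields either a reduction or the inequality
-- that discharging needs, and a finite search collects these alternatives.

private
  variable
    A B : Set
    xs ys : List A

-- Pigeonhole principles for lists and colour multiplicities

unique-⊆⇒length-≤ : Unique xs → (∀ {x} → x ∈ xs → x ∈ ys) → length xs ≤ length ys
unique-⊆⇒length-≤ [] _ = z≤n
unique-⊆⇒length-≤ {xs = x ∷ xs} (x∉xs ∷ u) xs⊆ys
  with as , bs , refl ← ∈-∃++ (xs⊆ys (here refl)) = begin
    suc (length xs)               ≤⟨ s≤s (unique-⊆⇒length-≤ u λ z∈xs →
                                       drop-x (All.lookup x∉xs z∈xs) (xs⊆ys (there z∈xs))) ⟩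
    suc (length (as ++ bs))       ≡⟨ cong suc (length-++ as) ⟩
    suc (length as + length bs)   ≡⟨ +-suc _ _ ⟨
    length as + suc (length bs)   ≡⟨ length-++ as ⟨
    length (as ++ x ∷ bs)         ∎
  where
  open ≤-Reasoning
  drop-x : ∀ {z} → x ≢ z → z ∈ as ++ x ∷ bs → z ∈ as ++ bs
  drop-x x≢z z∈ with ∈-++⁻ as z∈
  ... | inj₁ z∈as          = ∈-++⁺ˡ z∈as
  ... | inj₂ (here z≡x)    = contradiction (sym z≡x) x≢z
  ... | inj₂ (there z∈bs)  = ∈-++⁺ʳ as z∈bs

length-filter+filter-∁ : ∀ {P : Pred A 0ℓ} (P? : Decidable P) xs →
  length (filter P? xs) + length (filter (¬? ∘ P?) xs) ≡ length xs
length-filter+filter-∁ P? [] = refl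
length-filter+filter-∁ P? (x ∷ xs) with P? x
... | yes _ = cong suc (length-filter+filter-∁ P? xs)
... | no  _ = trans (+-suc _ _) (cong suc (length-filter+filter-∁ P? xs))

filter-absorb : ∀ {P Q : Pred A 0ℓ} (P? : Decidable P) (Q? : Decidable Q) →
  (∀ {x} → P x → Q x) → ∀ xs → filter P? (filter Q? xs) ≡ filter P? xs
filter-absorb P? Q? P⇒Q [] = refl
filter-absorb P? Q? P⇒Q (x ∷ xs) with Q? x
... | yes _ with P? x
...   | yes _ = cong (x ∷_) (filter-absorb P? Q? P⇒Q xs)
...   | no  _ = filter-absorb P? Q? P⇒Q xs
filter-absorb P? Q? P⇒Q (x ∷ xs) | no ¬q =
  trans (filter-absorb P? Q? P⇒Q xs) (sym (filter-reject P? (¬q ∘ P⇒Q)))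

fibre : (A → ℕ) → ℕ → List A → List A
fibre f a = filter (λ x → f x ℕ.≟ a)

frequent : ℕ → (A → ℕ) → List A → List ℕ → List ℕ
frequent t f xs = filter (λ a → t ≤? length (fibre f a xs))

-- Splitting off the fibre of `a` leaves every other fibre intact inside `rest`.
disjoint-fibres : ∀ t (f : A → ℕ) xs {as} → Unique as →
  All (λ a → t ≤ length (fibre f a xs)) as → length as * t ≤ length xs
disjoint-fibres t f xs [] [] = z≤n
disjoint-fibres t f xs {a ∷ as} (a∉as ∷ u) (t≤ ∷ ts≤) = begin
  t + length as * t                               ≤⟨ +-mono-≤ t≤ (disjoint-fibres t f rest u
                                                       (All.zipWith fibre-in-rest (a∉as , ts≤))) ⟩
  length (fibre f a xs) + length rest             ≡⟨ length-filter+filter-∁ (λ x → f x ℕ.≟ a) xs ⟩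
  length xs                                       ∎
  where
  open ≤-Reasoning
  rest = filter (λ x → ¬? (f x ℕ.≟ a)) xs
  fibre-in-rest : ∀ {b} → a ≢ b × t ≤ length (fibre f b xs) → t ≤ length (fibre f b rest)
  fibre-in-rest {b} (a≢b , t≤b) = subst (λ ys → t ≤ length ys)
    (sym (filter-absorb (λ x → f x ℕ.≟ b) (λ x → ¬? (f x ℕ.≟ a)) (λ { refl fx≡a → a≢b (sym fx≡a) }) xs)) t≤b

length-frequent : ∀ t (f : A → ℕ) xs {as} → Unique as →
  length (frequent t f xs as) * t ≤ length xs
length-frequent t f xs {as} u = disjoint-fibres t f xs (Unique.filter⁺ P? u) (all-filter P? as)
  where P? = λ a → t ≤? length (fibre f a xs)

∉-frequent : ∀ t (f : A → ℕ) xs {as a} → a ∈ as → a ∉ frequent t f xs as →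
  length (fibre f a xs) < t
∉-frequent t f xs a∈ a∉ = ≰⇒> λ t≤ → a∉ (∈-filter⁺ (λ a → t ≤? length (fibre f a xs)) a∈ t≤)

fibre-avoid : ∀ (f : A → ℕ) {xs a} → a ∉ map f xs → length (fibre f a xs) ≡ 0
fibre-avoid f {xs} a∉ = cong length (filter-none _ (All.tabulate λ x∈ fx≡a →
  a∉ (subst (_∈ map f xs) fx≡a (∈-map⁺ f x∈))))

pick : ∀ {as} forbidden → Unique as → length forbidden < length as →
  ∃[ a ] a ∈ as × a ∉ forbidden
pick {as} forbidden u short with any? (λ a → ¬? (a ∈ℕ? forbidden)) as
... | yes free = find free
... | no ¬free = contradiction
  (unique-⊆⇒length-≤ u λ {a} a∈ → decidable-stable (a ∈ℕ? forbidden) (All.lookup (¬Any⇒All¬ as ¬free) a∈))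
  (<⇒≱ short)

-- Sums and double counting

∑⟨_⟩_ : List A → (A → ℕ) → ℕ
∑⟨ xs ⟩ f = sum (map f xs)

∑-cong : ∀ xs {f g : A → ℕ} → (∀ {x} → x ∈ xs → f x ≡ g x) → ∑⟨ xs ⟩ f ≡ ∑⟨ xs ⟩ g
∑-cong []       eq = refl
∑-cong (x ∷ xs) eq = cong₂ _+_ (eq (here refl)) (∑-cong xs (eq ∘ there))

∑-mono : ∀ xs {f g : A → ℕ} → (∀ {x} → x ∈ xs → f x ≤ g x) → ∑⟨ xs ⟩ f ≤ ∑⟨ xs ⟩ g
∑-mono []       le = z≤n
∑-mono (x ∷ xs) le = +-mono-≤ (le (here refl)) (∑-mono xs (le ∘ there))

∑-+ : ∀ xs (f g : A → ℕ) → ∑⟨ xs ⟩ (λ x → f x + g x) ≡ ∑⟨ xs ⟩ f + ∑⟨ xs ⟩ g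
∑-+ []       f g = refl
∑-+ (x ∷ xs) f g = trans (cong (f x + g x +_) (∑-+ xs f g)) (shuffle (f x) _ _ _)
  where
  open import Algebra.Properties.CommutativeSemigroup +-commutativeSemigroup
  shuffle : ∀ a b c d → a + b + (c + d) ≡ a + c + (b + d)
  shuffle a b c d = interchange a b c d

∑-* : ∀ xs k (f : A → ℕ) → ∑⟨ xs ⟩ (λ x → k * f x) ≡ k * ∑⟨ xs ⟩ f
∑-* []       k f = sym (*-zeroʳ k)
∑-* (x ∷ xs) k f = trans (cong (k * f x +_) (∑-* xs k f)) (sym (*-distribˡ-+ k (f x) _))

∑-const : ∀ (xs : List A) k → ∑⟨ xs ⟩ (λ _ → k) ≡ length xs * k
∑-const []       k = refl
∑-const (x ∷ xs) k = cong (k +_) (∑-const xs k)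

-- Both sides sum `h` over the related pairs, grouped by either component; this later balances the
-- charge sent against the charge received.
∑-filter-swap : ∀ {R : A → B → Set} (R? : ∀ x y → Dec (R x y)) (h : A → B → ℕ) xs ys →
  ∑⟨ xs ⟩ (λ x → ∑⟨ filter (R? x) ys ⟩ (h x)) ≡ ∑⟨ ys ⟩ (λ y → ∑⟨ filter (flip R? y) xs ⟩ (flip h y))
∑-filter-swap R? h [] ys = sym (trans (∑-const ys 0) (*-zeroʳ (length ys)))
∑-filter-swap R? h (x ∷ xs) ys = trans (cong (∑⟨ filter (R? x) ys ⟩ (h x) +_) (∑-filter-swap R? h xs ys)) (row ys)
  where
  open import Algebra.Properties.CommutativeSemigroup +-commutativeSemigroup
  col = λ y → ∑⟨ filter (flip R? y) xs ⟩ (flip h y)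
  row : ∀ ys → ∑⟨ filter (R? x) ys ⟩ (h x) + ∑⟨ ys ⟩ col
             ≡ ∑⟨ ys ⟩ (λ y → ∑⟨ filter (flip R? y) (x ∷ xs) ⟩ (flip h y))
  row [] = refl
  row (y ∷ ys) with R? x y
  ... | yes _ = trans (interchange (h x y) _ (col y) _) (cong (h x y + col y +_) (row ys))
  ... | no  _ = trans (x∙yz≈y∙xz (∑⟨ filter (R? x) ys ⟩ (h x)) (col y) (∑⟨ ys ⟩ col)) (cong (col y +_) (row ys))

length-filter-cartesianProduct : ∀ {R : A × B → Set} (R? : ∀ p → Dec (R p)) xs ys →
  length (filter R? (cartesianProduct xs ys)) ≡ ∑⟨ xs ⟩ (λ x → length (filter (λ y → R? (x , y)) ys))
length-filter-cartesianProduct R? [] ys = refl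
length-filter-cartesianProduct R? (x ∷ xs) ys = begin
  length (filter R? (map (x ,_) ys ++ cartesianProduct xs ys))
    ≡⟨ cong length (filter-++ R? (map (x ,_) ys) _) ⟩
  length (filter R? (map (x ,_) ys) ++ filter R? (cartesianProduct xs ys))
    ≡⟨ length-++ (filter R? (map (x ,_) ys)) ⟩
  length (filter R? (map (x ,_) ys)) + length (filter R? (cartesianProduct xs ys))
    ≡⟨ cong₂ _+_ (row ys) (length-filter-cartesianProduct R? xs ys) ⟩
  length (filter (λ y → R? (x , y)) ys) + ∑⟨ xs ⟩ (λ x → length (filter (λ y → R? (x , y)) ys)) ∎
  where
  open ≡-Reasoning
  row : ∀ ys → length (filter R? (map (x ,_) ys)) ≡ length (filter (λ y → R? (x , y)) ys)
  row [] = refl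
  row (y ∷ ys) with R? (x , y)
  ... | yes _ = cong suc (row ys)
  ... | no  _ = row ys

length-filter-tabulate : ∀ {m} {P : Pred A 0ℓ} (P? : Decidable P) (f : Fin m → A) →
  length (filter P? (List.tabulate f)) ≡ size (Vec.tabulate (λ i → does (P? (f i))))
length-filter-tabulate {m = zero}  P? f = refl
length-filter-tabulate {m = suc m} P? f with does (P? (f zero))
... | true  = cong suc (length-filter-tabulate P? (f ∘ suc))
... | false = length-filter-tabulate P? (f ∘ suc)

-- The cyclic order on Fin

module _ {m : ℕ} where

  -- A `Cycle` treats its closing edge separately; a cyclic successor lets it be entered at any
  -- vertex, in particular at the one just coloured.
  next : Fin (suc m) → Fin (suc m)
  next i with view i
  ... | ‵fromℕ     = zero
  ... | ‵inject₁ j = suc j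

  prev : Fin (suc m) → Fin (suc m)
  prev zero    = fromℕ m
  prev (suc j) = inject₁ j

  next-prev : ∀ i → next (prev i) ≡ i
  next-prev zero    rewrite view-fromℕ m = refl
  next-prev (suc j) rewrite view-inject₁ j = refl

  prev-next : ∀ i → prev (next i) ≡ i
  prev-next i with view i
  ... | ‵fromℕ     = refl
  ... | ‵inject₁ j = refl

-- This is where the length of at least three enters; it also keeps a walk around the cycle from
-- returning after two steps.
next≢prev : ∀ {m} (i : Fin (3 + m)) → next i ≢ prev i
next≢prev {m} i with view i
... | ‵fromℕ             = λ ()
... | ‵inject₁ zero      = λ ()
... | ‵inject₁ (suc j)   = λ eq → <⇒≢ (m<n⇒m<1+n (n<1+n (toℕ j))) (sym (begin
  suc (suc (toℕ j))           ≡⟨ cong toℕ eq ⟩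
  toℕ (inject₁ (inject₁ j))   ≡⟨ Fin.toℕ-inject₁ (inject₁ j) ⟩
  toℕ (inject₁ j)             ≡⟨ Fin.toℕ-inject₁ j ⟩
  toℕ j                       ∎))
  where open ≡-Reasoning

next²≢ : ∀ {m} (i : Fin (3 + m)) → next (next i) ≢ i
next²≢ i eq = next≢prev i (trans (sym (prev-next (next i))) (cong prev eq))

prev²≢ : ∀ {m} (i : Fin (3 + m)) → prev (prev i) ≢ i
prev²≢ i eq = next≢prev i (sym (trans (sym (next-prev (prev i))) (cong next eq)))

-- Forested colourings of induced subgraphs and their extension by a vertex

module _ {n : ℕ} where

  ∈-─⁻ : ∀ {m} {x : Fin m} (p q : Subset m) → x ∈ˢ p ─ q → x ∉ˢ q
  ∈-─⁻ (_ Vec.∷ p) (_ Vec.∷ q) (Vec.there x∈) (Vec.there x∈q) = ∈-─⁻ p q x∈ x∈q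
  ∈-─⁻ (inside Vec.∷ p) (inside Vec.∷ q) () Vec.here
  ∈-─⁻ (outside Vec.∷ p) (inside Vec.∷ q) () Vec.here

  ∈-delete⁻ : ∀ {S : Subset n} {v x} → x ∈ˢ S - v → x ∈ˢ S × x ≢ v
  ∈-delete⁻ {S} {v} x∈ = p─q⊆p S _ x∈ , λ { refl → ∈-─⁻ S _ x∈ (x∈⁅x⁆ v) }

  _[_↦_] : (Fin n → ℕ) → Fin n → ℕ → Fin n → ℕ
  (c [ v ↦ a ]) x = if does (x Fin.≟ v) then a else c x

  update-same : ∀ (c : Fin n → ℕ) v a → (c [ v ↦ a ]) v ≡ a
  update-same c v a with v Fin.≟ v
  ... | yes _  = refl
  ... | no v≢v = contradiction refl v≢v

  update-other : ∀ (c : Fin n → ℕ) {v x} a → x ≢ v → (c [ v ↦ a ]) x ≡ c x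
  update-other c {v} {x} a x≢v with x Fin.≟ v
  ... | yes x≡v = contradiction x≡v x≢v
  ... | no  _   = refl

module InducedSubgraphs {n : ℕ} (G : Graph n) where

  open Graph G

  ~⇒≢ : ∀ {u v} → u ~ v → u ≢ v
  ~⇒≢ u~v refl = ~-irrefl refl u~v

  elements : Subset n → List (Fin n)
  elements S = filter (_∈ˢ? S) (allFin n)

  ∈-elements⁺ : ∀ {S v} → v ∈ˢ S → v ∈ elements S
  ∈-elements⁺ {S} v∈S = ∈-filter⁺ (_∈ˢ? S) (∈-allFin _) v∈S

  ∈-elements⁻ : ∀ {S v} → v ∈ elements S → v ∈ˢ S
  ∈-elements⁻ {S} v∈ = proj₂ (∈-filter⁻ (_∈ˢ? S) {xs = allFin n} v∈)

  nbrs : Subset n → Fin n → List (Fin n)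
  nbrs S v = filter (v ~?_) (elements S)

  elements-unique : ∀ S → Unique (elements S)
  elements-unique S = Unique.filter⁺ (_∈ˢ? S) (Unique.allFin⁺ n)

  nbrs-unique : ∀ S v → Unique (nbrs S v)
  nbrs-unique S v = Unique.filter⁺ (v ~?_) (elements-unique S)

  ∈-nbrs⁺ : ∀ {S v x} → x ∈ˢ S → v ~ x → x ∈ nbrs S v
  ∈-nbrs⁺ {S} {v} x∈S v~x = ∈-filter⁺ (v ~?_) (∈-elements⁺ x∈S) v~x

  ∈-nbrs⁻ : ∀ {S v x} → x ∈ nbrs S v → x ∈ˢ S × v ~ x
  ∈-nbrs⁻ {S} {v} x∈ with x∈S , v~x ← ∈-filter⁻ (v ~?_) {xs = elements S} x∈ = ∈-elements⁻ x∈S , v~x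

  deg : Subset n → Fin n → ℕ
  deg S v = length (nbrs S v)

  deg-mono : ∀ {S T} v → (∀ {x} → x ∈ˢ S → x ∈ˢ T) → deg S v ≤ deg T v
  deg-mono {S} v S⊆T = unique-⊆⇒length-≤ (nbrs-unique S v) λ x∈ →
    let x∈S , v~x = ∈-nbrs⁻ x∈ in ∈-nbrs⁺ (S⊆T x∈S) v~x

  deg-delete : ∀ {S u v} → v ∈ˢ S → u ~ v → deg (S - v) u < deg S u
  deg-delete {S} {u} {v} v∈S u~v = unique-⊆⇒length-≤
    (All.tabulate (λ x∈ v≡x → proj₂ (∈-delete⁻ (proj₁ (∈-nbrs⁻ x∈))) (sym v≡x)) ∷ nbrs-unique (S - v) u)
    λ { (here refl) → ∈-nbrs⁺ v∈S u~v
      ; (there x∈) → let x∈- , u~x = ∈-nbrs⁻ x∈ in ∈-nbrs⁺ (proj₁ (∈-delete⁻ x∈-)) u~x }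

  ∈-fibre⁻ : ∀ (c : Fin n → ℕ) {a S v x} → x ∈ fibre c a (nbrs S v) → x ∈ˢ S × v ~ x × c x ≡ a
  ∈-fibre⁻ c {a} {S} {v} x∈ with x∈N , cx≡a ← ∈-filter⁻ (λ x → c x ℕ.≟ a) {xs = nbrs S v} x∈ =
    let x∈S , v~x = ∈-nbrs⁻ x∈N in x∈S , v~x , cx≡a

  ∈-fibre⁺ : ∀ (c : Fin n → ℕ) {a S v x} → x ∈ˢ S → v ~ x → c x ≡ a → x ∈ fibre c a (nbrs S v)
  ∈-fibre⁺ c x∈S v~x cx≡a = ∈-filter⁺ (λ x → c x ℕ.≟ _) (∈-nbrs⁺ x∈S v~x) cx≡a

  fibre-unique : ∀ (c : Fin n → ℕ) a S v → Unique (fibre c a (nbrs S v))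
  fibre-unique c a S v = Unique.filter⁺ (λ x → c x ℕ.≟ a) (nbrs-unique S v)

  cycle-step : ∀ (C : Cycle G) i → Cycle.vertex C i ~ Cycle.vertex C (next i)
  cycle-step C i with view i
  ... | ‵fromℕ     = Cycle.close C
  ... | ‵inject₁ j = Cycle.step C j

  BicolouredCycle : Subset n → (Fin n → ℕ) → Set
  BicolouredCycle S c = Σ[ C ∈ Cycle G ] ∃[ a ] ∃[ b ]
    (∀ i → Cycle.vertex C i ∈ˢ S × (c (Cycle.vertex C i) ≡ a ⊎ c (Cycle.vertex C i) ≡ b))

  -- The condition for k = t + 1: by properness, the degree of v in a
  -- two-coloured subgraph is the number of its neighbours of the other colour.
  record Forested (t : ℕ) (S : Subset n) (c : Fin n → ℕ) : Set where
    field
      proper  : ∀ {u v} → u ∈ˢ S → v ∈ˢ S → u ~ v → c u ≢ c v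
      sparse  : ∀ {v} → v ∈ˢ S → ∀ a → length (fibre c a (nbrs S v)) ≤ t
      acyclic : ¬ BicolouredCycle S c

  -- A bicoloured walk that starts with a new vertex of colour a and passes
  -- through u stops at distance at most two from it.
  DeadEnd : Subset n → (Fin n → ℕ) → ℕ → Fin n → Set
  DeadEnd S c a u = ∀ {y z} → y ∈ˢ S → z ∈ˢ S → u ~ y → c y ≡ a → y ~ z → z ≢ u → c z ≢ c u

  alternate : ∀ {a b x y z : ℕ} → x ≡ a ⊎ x ≡ b → y ≡ a ⊎ y ≡ b → z ≡ a ⊎ z ≡ b →
    x ≢ y → y ≢ z → x ≡ z
  alternate (inj₁ refl) _           (inj₁ refl) _   _   = refl
  alternate (inj₂ refl) _           (inj₂ refl) _   _   = refl
  alternate (inj₁ refl) (inj₁ refl) (inj₂ refl) x≢y _   = contradiction refl x≢y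
  alternate (inj₁ refl) (inj₂ refl) (inj₂ refl) _   y≢z = contradiction refl y≢z
  alternate (inj₂ refl) (inj₁ refl) (inj₁ refl) _   y≢z = contradiction refl y≢z
  alternate (inj₂ refl) (inj₂ refl) (inj₁ refl) x≢y _   = contradiction refl x≢y

  -- A new two-coloured cycle passes through `v`, and the two vertices next to `v` on it have the
  -- same colour, so one of them is a dead end. Two steps beyond that one the walk meets its colour
  -- again, at a vertex other than `v`, which is exactly what `DeadEnd` excludes.
  extend : ∀ {t S c v a} → v ∈ˢ S → Forested t (S - v) c →
    deg S v ≤ t →
    (∀ {u} → u ∈ˢ S → v ~ u → c u ≢ a) →
    (∀ {u} → u ∈ˢ S → v ~ u → length (fibre c a (nbrs (S - v) u)) < t) →
    (∀ {u w} → u ∈ˢ S → v ~ u → w ∈ˢ S → v ~ w → u ≢ w → c u ≡ c w →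
      DeadEnd (S - v) c a u ⊎ DeadEnd (S - v) c a w) →
    Forested t S (c [ v ↦ a ])
  extend {t} {S} {c} {v} {a} v∈S good small fresh room dead = record
    { proper = proper′ ; sparse = sparse′ ; acyclic = acyclic′ }
    where
    open Forested good
    c′ = c [ v ↦ a ]

    inner : ∀ {x} → x ∈ˢ S → x ≢ v → x ∈ˢ S - v
    inner = x∈p∧x≢y⇒x∈p-y

    old : ∀ {x} → x ≢ v → c′ x ≡ c x
    old = update-other c a

    new : c′ v ≡ a
    new = update-same c v a

    proper′ : ∀ {x y} → x ∈ˢ S → y ∈ˢ S → x ~ y → c′ x ≢ c′ y
    proper′ {x} {y} x∈S y∈S x~y eq with x Fin.≟ v | y Fin.≟ v
    ... | yes refl | yes refl = ~⇒≢ x~y refl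
    ... | yes refl | no  y≢v  = fresh y∈S x~y (sym eq)
    ... | no  x≢v  | yes refl = fresh x∈S (~-sym x~y) eq
    ... | no  x≢v  | no  y≢v  = proper (inner x∈S x≢v) (inner y∈S y≢v) x~y eq

    sparse-old : ∀ {y b} → y ∈ˢ S → y ≢ v → ¬ (y ~ v × a ≡ b) → length (fibre c′ b (nbrs S y)) ≤ t
    sparse-old {y} {b} y∈S y≢v irrelevant = ≤-trans
      (unique-⊆⇒length-≤ (fibre-unique c′ b S y) λ {x} x∈ →
        let x∈S , y~x , cx≡b = ∈-fibre⁻ c′ x∈
            x≢v = λ { refl → irrelevant (y~x , trans (sym new) cx≡b) }
        in ∈-fibre⁺ c (inner x∈S x≢v) y~x (trans (sym (old x≢v)) cx≡b))
      (sparse (inner y∈S y≢v) b)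

    sparse′ : ∀ {y} → y ∈ˢ S → ∀ b → length (fibre c′ b (nbrs S y)) ≤ t
    sparse′ {y} y∈S b with y Fin.≟ v
    ... | yes refl = ≤-trans (length-filter (λ x → c′ x ℕ.≟ b) (nbrs S v)) small
    ... | no y≢v with y ~? v | a ℕ.≟ b
    ...   | no y≁v  | _        = sparse-old y∈S y≢v λ (y~v , _) → y≁v y~v
    ...   | yes _   | no a≢b   = sparse-old y∈S y≢v λ (_ , a≡b) → a≢b a≡b
    -- The only multiplicity that grows: `v` joins the neighbours of `y` coloured `a`, and `room`
    -- left a place for it.
    ...   | yes y~v | yes refl = ≤-trans
      (unique-⊆⇒length-≤ {ys = v ∷ fibre c a (nbrs (S - v) y)} (fibre-unique c′ a S y) ⊆)
      (room y∈S (~-sym y~v))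
      where
      ⊆ : ∀ {x} → x ∈ fibre c′ a (nbrs S y) → x ∈ v ∷ fibre c a (nbrs (S - v) y)
      ⊆ {x} x∈ with x∈S , y~x , cx≡a ← ∈-fibre⁻ c′ x∈ | x Fin.≟ v
      ... | yes x≡v = here x≡v
      ... | no  x≢v = there (∈-fibre⁺ c (inner x∈S x≢v) y~x cx≡a)

    acyclic′ : ¬ BicolouredCycle S c′
    acyclic′ (C , α , β , bi) with Fin.any? (λ i → Cycle.vertex C i Fin.≟ v)
    ... | no avoids = acyclic (C , α , β , λ i →
      let i∈S , colour = bi i ; i≢v = λ eq → avoids (i , eq) in
      inner i∈S i≢v , subst (λ x → x ≡ α ⊎ x ≡ β) (old i≢v) colour)
    -- Follow the cycle away from `v` in the direction of whichever neighbour is the dead end.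
    ... | yes (i , refl) = [ refute (next i) (next (next i)) (next (next (next i)))
                                    (step⁺ i) (step⁺ (next i)) (step⁺ (next (next i)))
                                    (next²≢ i) (next²≢ (next i))
                           , refute (prev i) (prev (prev i)) (prev (prev (prev i)))
                                    (step⁻ i) (step⁻ (prev i)) (step⁻ (prev (prev i)))
                                    (prev²≢ i) (prev²≢ (prev i)) ]′
      (dead (in-S (next i)) (step⁺ i) (in-S (prev i)) (step⁻ i)
            (next≢prev i ∘ injective) same)
      where
      open Cycle C
      in-S = proj₁ ∘ bi

      step⁺ : ∀ j → vertex j ~ vertex (next j)
      step⁺ = cycle-step C

      step⁻ : ∀ j → vertex j ~ vertex (prev j)
      step⁻ j = ~-sym (subst (λ l → vertex (prev j) ~ vertex l) (next-prev j) (step⁺ (prev j)))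

      alternates : ∀ {j l m} → vertex j ~ vertex l → vertex l ~ vertex m → c′ (vertex j) ≡ c′ (vertex m)
      alternates {j} {l} {m} j~l l~m = alternate (proj₂ (bi j)) (proj₂ (bi l)) (proj₂ (bi m))
        (proper′ (in-S j) (in-S l) j~l) (proper′ (in-S l) (in-S m) l~m)

      same : c (vertex (next i)) ≡ c (vertex (prev i))
      same = trans (sym (old (≢-sym (~⇒≢ (step⁺ i)))))
        (trans (alternates (~-sym (step⁺ i)) (step⁻ i)) (old (≢-sym (~⇒≢ (step⁻ i)))))

      refute : ∀ j l m → vertex i ~ vertex j → vertex j ~ vertex l → vertex l ~ vertex m →
        l ≢ i → m ≢ j → ¬ DeadEnd (S - v) c a (vertex j)
      refute j l m i~j j~l l~m l≢i m≢j stops = stops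
        (inner (in-S l) l≢v) (inner (in-S m) m≢v) j~l
        (trans (sym (old l≢v)) (trans (sym (alternates i~j j~l)) new))
        l~m (m≢j ∘ injective)
        (trans (sym (old m≢v)) (trans (sym (alternates j~l l~m)) (old (≢-sym (~⇒≢ i~j)))))
        where
        l≢v : vertex l ≢ v
        l≢v = l≢i ∘ injective
        m≢v : vertex m ≢ v
        m≢v eq = proper′ (in-S i) (in-S j) i~j
          (sym (trans (alternates j~l l~m) (cong c′ eq)))

-- Extending partial colourings by one vertex

module Reductions {n : ℕ} (G : Graph n) (t M : ℕ) (3≤t : 3 ≤ t)
  (bounded : ∀ S v → InducedSubgraphs.deg G S v ≤ M * t)
  (L : Fin n → List ℕ) (L-unique : ∀ v → Unique (L v)) where

  open Graph G
  open InducedSubgraphs G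

  Colouring : Subset n → Set
  Colouring S = Σ[ c ∈ (Fin n → ℕ) ] Forested t S c × (∀ {v} → v ∈ˢ S → c v ∈ L v)

  extend-list : ∀ {S v a} {c : Fin n → ℕ} → (∀ {x} → x ∈ˢ S - v → c x ∈ L x) → a ∈ L v →
    ∀ {x} → x ∈ˢ S → (c [ v ↦ a ]) x ∈ L x
  extend-list {v = v} listed a∈ {x} x∈S with x Fin.≟ v
  ... | yes refl = a∈
  ... | no  x≢v  = listed (x∈p∧x≢y⇒x∈p-y x∈S x≢v)

  -- Restricted to `L v`, since only colours available to `v` can overload `u`.
  saturated : Subset n → (Fin n → ℕ) → Fin n → Fin n → List ℕ
  saturated T c v u = frequent t c (nbrs T u) (L v)

  length-saturated : ∀ T c v u → length (saturated T c v u) * t ≤ deg T u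
  length-saturated T c v u = length-frequent t c (nbrs T u) (L-unique v)

  few-saturated : ∀ T c v u {m} → deg T u < m * t → length (saturated T c v u) < m
  few-saturated T c v u d< = *-cancelʳ-< _ _ _ (≤-<-trans (length-saturated T c v u) d<)

  saturated-after-deletion : ∀ {S v u} → v ∈ˢ S → v ~ u → ∀ c → length (saturated (S - v) c v u) < M
  saturated-after-deletion {S} {v} {u} v∈S v~u c =
    few-saturated (S - v) c v u (<-≤-trans (deg-delete v∈S (~-sym v~u)) (bounded S u))

  unsaturated : ∀ {T c v u a} → a ∈ L v → a ∉ saturated T c v u → length (fibre c a (nbrs T u)) < t
  unsaturated {T} {c} {u = u} = ∉-frequent t c (nbrs T u)

  low-degree-unsaturated : ∀ {T u d} c {a} → deg T u ≤ d → d < t → length (fibre c a (nbrs T u)) < t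
  low-degree-unsaturated {T} {u} c {a} deg≤d d<t =
    ≤-<-trans (length-filter (λ x → c x ℕ.≟ a) (nbrs T u)) (≤-<-trans deg≤d d<t)

  avoided-unsaturated : ∀ {T u} c {a} → a ∉ map c (nbrs T u) → length (fibre c a (nbrs T u)) < t
  avoided-unsaturated c a∉ = subst (_< t) (sym (fibre-avoid c a∉)) (≤-trans (s≤s z≤n) 3≤t)

  avoided-deadEnd : ∀ {T u} c {a} → a ∉ map c (nbrs T u) → DeadEnd T c a u
  avoided-deadEnd {T} {u} c {a} a∉ y∈T _ u~y cy≡a _ _ =
    contradiction (subst (_∈ map c (nbrs T u)) cy≡a (∈-map⁺ c (∈-nbrs⁺ y∈T u~y))) a∉

  record TwoNeighbours (S : Subset n) (v u w : Fin n) : Set where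
    field
      u∈S  : u ∈ˢ S
      w∈S  : w ∈ˢ S
      v~u  : v ~ u
      v~w  : v ~ w
      u≢w  : u ≢ w
      only : ∀ {x} → x ∈ˢ S → v ~ x → x ≡ u ⊎ x ≡ w

  swapped : ∀ {S v u w} → TwoNeighbours S v u w → TwoNeighbours S v w u
  swapped two = record
    { u∈S = w∈S ; w∈S = u∈S ; v~u = v~w ; v~w = v~u ; u≢w = ≢-sym u≢w
    ; only = λ x∈S v~x → [ inj₂ , inj₁ ]′ (only x∈S v~x) }
    where open TwoNeighbours two

  twoNeighbours : ∀ {S v} → deg S v ≡ 2 →
    ∃[ u ] ∃[ w ] TwoNeighbours S v u w × nbrs S v ≡ u ∷ w ∷ []
  twoNeighbours {S} {v} deg≡2 with nbrs S v in eq
  twoNeighbours {S} {v} refl | u ∷ w ∷ [] = u , w , record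
    { u∈S = proj₁ (∈-nbrs⁻ u∈) ; w∈S = proj₁ (∈-nbrs⁻ w∈)
    ; v~u = proj₂ (∈-nbrs⁻ u∈) ; v~w = proj₂ (∈-nbrs⁻ w∈)
    ; u≢w = All.head (AllPairs.head (subst Unique eq (nbrs-unique S v)))
    ; only = λ x∈S v~x → only (subst (_ ∈_) eq (∈-nbrs⁺ x∈S v~x)) } , refl
    where
    u∈ : u ∈ nbrs S v
    u∈ = subst (u ∈_) (sym eq) (here refl)
    w∈ : w ∈ nbrs S v
    w∈ = subst (w ∈_) (sym eq) (there (here refl))
    only : ∀ {x} → x ∈ u ∷ w ∷ [] → x ≡ u ⊎ x ≡ w
    only (here x≡u)         = inj₁ x≡u
    only (there (here x≡w)) = inj₂ x≡w

  otherNeighbour : ∀ {S v u} → deg S v ≡ 2 → u ∈ˢ S → v ~ u → ∃[ w ] TwoNeighbours S v u w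
  otherNeighbour deg≡2 u∈S v~u with p , r , two , _ ← twoNeighbours deg≡2
    with TwoNeighbours.only two u∈S v~u
  ... | inj₁ refl = r , two
  ... | inj₂ refl = p , swapped two

  deg-two : ∀ {S v u w} → TwoNeighbours S v u w → deg S v ≤ 2
  deg-two {S} {v} {u} {w} two = unique-⊆⇒length-≤ {ys = u ∷ w ∷ []} (nbrs-unique S v) λ x∈ →
    let x∈S , v~x = ∈-nbrs⁻ x∈ in [ here , there ∘ here ]′ (TwoNeighbours.only two x∈S v~x)

  Placement : Subset n → (Fin n → ℕ) → Fin n → Set
  Placement S c v = ∃[ a ] a ∈ L v × Forested t S (c [ v ↦ a ])

  placed : ∀ {S c v} → (∀ {x} → x ∈ˢ S - v → c x ∈ L x) → Placement S c v → Colouring S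
  placed {c = c} {v} listed (a , a∈ , good) = c [ v ↦ a ] , good , extend-list listed a∈

  -- Covers degrees 0 and 1 together: without neighbours, `u` is a dummy, which is why the condition
  -- on saturated colours is guarded by `v ~ u`.
  place₁ : ∀ {S c v u} → v ∈ˢ S → Forested t (S - v) c → (forbidden : List ℕ) →
    (∀ {x} → x ∈ˢ S → v ~ x → x ≡ u) →
    c u ∈ forbidden →
    ∀ {a} → a ∈ L v → a ∉ forbidden →
    (v ~ u → a ∉ saturated (S - v) c v u) →
    Forested t S (c [ v ↦ a ])
  place₁ {S} {c} {v} {u} v∈S good forbidden only cu∈ {a} a∈ a∉ unsat = extend v∈S good
    (≤-trans (unique-⊆⇒length-≤ {ys = u ∷ []} (nbrs-unique S v) λ x∈ →
       let x∈S , v~x = ∈-nbrs⁻ x∈ in here (only x∈S v~x)) (≤-trans (s≤s z≤n) 3≤t))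
    (λ { x∈S v~x refl → a∉ (subst (λ x → c x ∈ forbidden) (sym (only x∈S v~x)) cu∈) })
    (λ { x∈S v~x → room (only x∈S v~x) v~x })
    (λ x∈S v~x y∈S v~y x≢y _ → contradiction (trans (only x∈S v~x) (sym (only y∈S v~y))) x≢y)
    where
    room : ∀ {x} → x ≡ u → v ~ x → length (fibre c a (nbrs (S - v) x)) < t
    room refl v~u = unsaturated {c = c} a∈ (unsat v~u)

  place₂ : ∀ {S c v u w} → v ∈ˢ S → TwoNeighbours S v u w → Forested t (S - v) c →
    (forbidden : List ℕ) → length forbidden < length (L v) →
    c u ∈ forbidden → c w ∈ forbidden →
    (∀ {a} → a ∈ L v → a ∉ forbidden →
      length (fibre c a (nbrs (S - v) u)) < t × length (fibre c a (nbrs (S - v) w)) < t ×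
      (c u ≡ c w → DeadEnd (S - v) c a u ⊎ DeadEnd (S - v) c a w)) →
    Placement S c v
  place₂ {S} {c} {v} {u} {w} v∈S two good forbidden short cu∈ cw∈ fits
    with a , a∈ , a∉ ← pick forbidden (L-unique v) short
    with room-u , room-w , dead ← fits a∈ a∉ = a , a∈ , extend v∈S good
      (≤-trans (deg-two two) (≤-trans (s≤s (s≤s z≤n)) 3≤t))
      (λ x∈S v~x → fresh (only x∈S v~x))
      (λ x∈S v~x → room (only x∈S v~x))
      (λ x∈S v~x y∈S v~y → ends (only x∈S v~x) (only y∈S v~y))
    where
    open TwoNeighbours two
    fresh : ∀ {x} → x ≡ u ⊎ x ≡ w → c x ≢ a
    fresh (inj₁ refl) refl = a∉ cu∈
    fresh (inj₂ refl) refl = a∉ cw∈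
    room : ∀ {x} → x ≡ u ⊎ x ≡ w → length (fibre c a (nbrs (S - v) x)) < t
    room (inj₁ refl) = room-u
    room (inj₂ refl) = room-w
    ends : ∀ {x y} → x ≡ u ⊎ x ≡ w → y ≡ u ⊎ y ≡ w → x ≢ y → c x ≡ c y →
      DeadEnd (S - v) c a x ⊎ DeadEnd (S - v) c a y
    ends (inj₁ refl) (inj₁ refl) x≢y = contradiction refl x≢y
    ends (inj₁ refl) (inj₂ refl) _ eq = dead eq
    ends (inj₂ refl) (inj₁ refl) _ eq = [ inj₂ , inj₁ ]′ (dead (sym eq))
    ends (inj₂ refl) (inj₂ refl) x≢y = contradiction refl x≢y

  -- After the removal of `v`, `u` has at most `e < t` neighbours, so it saturates nothing. If `c u`
  -- and `c w` differ, they cost 2, which is at most `suc e`. If they agree, they cost 1, and the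
  -- other `e` colours are spent on avoiding everything around `u`, which makes `u` a dead end.
  place-low-degree : ∀ {S c v u w e} → v ∈ˢ S → TwoNeighbours S v u w → Forested t (S - v) c →
    deg S u ≤ suc e → 1 ≤ e → e < t →
    suc e + length (saturated (S - v) c v w) < length (L v) → Placement S c v
  place-low-degree {S} {c} {v} {u} {w} {e} v∈S two good deg≤ 1≤e e<t short with c u ℕ.≟ c w
  ... | no cu≢cw = place₂ v∈S two good (c u ∷ c w ∷ sat)
    (≤-<-trans (s≤s (+-monoˡ-≤ (length sat) 1≤e)) short)
    (here refl) (there (here refl))
    λ a∈ a∉ → low-degree-unsaturated c degT≤ e<t , unsaturated {c = c} a∈ (a∉ ∘ there ∘ there) ,
      λ cu≡cw → contradiction cu≡cw cu≢cw
    where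
    sat = saturated (S - v) c v w
    degT≤ = s≤s⁻¹ (≤-trans (deg-delete v∈S (~-sym (TwoNeighbours.v~u two))) deg≤)
  ... | yes cu≡cw = place₂ v∈S two good (c u ∷ palette ++ sat)
    (≤-<-trans (s≤s (≤-trans (≤-reflexive (length-++ palette))
      (+-monoˡ-≤ (length sat) (≤-trans (≤-reflexive (length-map c (nbrs (S - v) u))) degT≤)))) short)
    (here refl) (here (sym cu≡cw))
    λ a∈ a∉ → low-degree-unsaturated c degT≤ e<t ,
      unsaturated {c = c} a∈ (a∉ ∘ there ∘ ∈-++⁺ʳ palette) ,
      λ _ → inj₁ (avoided-deadEnd c (a∉ ∘ there ∘ ∈-++⁺ˡ))
    where
    sat     = saturated (S - v) c v w
    palette = map c (nbrs (S - v) u)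
    degT≤   = s≤s⁻¹ (≤-trans (deg-delete v∈S (~-sym (TwoNeighbours.v~u two))) deg≤)

  -- With four colours, `place-low-degree` for `e = 2` works unless `w` has a saturated colour. As
  -- `w` keeps at most 4 neighbours, fewer than `2 * t`, there is then exactly one, and if `c u` and
  -- `c w` agree the dead end is sought at `w` instead of `u`.
  place-3-5 : ∀ {S c v u w} → v ∈ˢ S → TwoNeighbours S v u w → Forested t (S - v) c →
    deg S u ≤ 3 → deg S w ≤ 5 → 4 ≤ length (L v) → Placement S c v
  place-3-5 {S} {c} {v} {u} {w} v∈S two good degu degw 4≤L
    with saturated (S - v) c v w in eq
  ... | [] = place-low-degree v∈S two good degu (s≤s z≤n) 3≤t
               (subst (λ s → 3 + length s < length (L v)) (sym eq) 4≤L)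
  ... | b ∷ bs with c u ℕ.≟ c w
  ...   | no cu≢cw = place₂ v∈S two good (c u ∷ c w ∷ sat)
    (<-≤-trans (s≤s (s≤s (few-saturated (S - v) c v w {2} degT<2t))) 4≤L)
    (here refl) (there (here refl))
    λ a∈ a∉ → low-degree-unsaturated c (s≤s⁻¹ (≤-trans (deg-delete v∈S (~-sym (TwoNeighbours.v~u two))) degu)) 3≤t ,
      unsaturated {c = c} a∈ (a∉ ∘ there ∘ there) ,
      λ cu≡cw → contradiction cu≡cw cu≢cw
    where
    sat = saturated (S - v) c v w
    degT<2t : deg (S - v) w < 2 * t
    degT<2t = ≤-trans (≤-trans (deg-delete v∈S (~-sym (TwoNeighbours.v~w two))) degw)
      (≤-trans (n≤1+n 5) (*-monoʳ-≤ 2 3≤t))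
  -- b uses up at least three of the at most four other neighbours of w, so all
  -- colours occurring around w can be avoided.
  ...   | yes cu≡cw = place₂ v∈S two good (c u ∷ b ∷ map c rest)
    (<-≤-trans (s≤s (s≤s (≤-<-trans (≤-reflexive (length-map c rest)) (s≤s rest≤1)))) 4≤L)
    (here refl) (here (sym cu≡cw))
    λ {a} a∈ a∉ →
      let avoided : a ∉ map c (nbrs (S - v) w)
          avoided = avoid a∉
      in low-degree-unsaturated c (s≤s⁻¹ (≤-trans (deg-delete v∈S (~-sym (TwoNeighbours.v~u two))) degu)) 3≤t ,
         avoided-unsaturated c avoided ,
         λ _ → inj₂ (avoided-deadEnd c avoided)
    where
    N    = nbrs (S - v) w
    rest = filter (λ x → ¬? (c x ℕ.≟ b)) N
    t≤fibre : t ≤ length (fibre c b N)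
    t≤fibre = proj₂ (∈-filter⁻ (λ a → t ≤? length (fibre c a N)) {xs = L v}
      (subst (b ∈_) (sym eq) (here refl)))
    rest≤1 : length rest ≤ 1
    rest≤1 = +-cancelˡ-≤ 3 _ _ (begin
      3 + length rest                        ≤⟨ +-monoˡ-≤ (length rest) (≤-trans 3≤t t≤fibre) ⟩
      length (fibre c b N) + length rest     ≡⟨ length-filter+filter-∁ (λ x → c x ℕ.≟ b) N ⟩
      length N                               ≤⟨ s≤s⁻¹ (≤-trans (deg-delete v∈S (~-sym (TwoNeighbours.v~w two))) degw) ⟩
      4                                      ∎)
      where open ≤-Reasoning
    avoid : ∀ {a} → a ∉ c u ∷ b ∷ map c rest → a ∉ map c N
    avoid a∉ a∈ with x , x∈N , refl ← ∈-map⁻ c a∈ with c x ℕ.≟ b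
    ... | yes cx≡b = a∉ (there (here cx≡b))
    ... | no  cx≢b = a∉ (there (there (∈-map⁺ c (∈-filter⁺ (λ x → ¬? (c x ℕ.≟ b)) x∈N cx≢b))))

-- Reducible configurations

module ReducibleConfigurations {n : ℕ} (G : Graph n) (t M : ℕ) (3≤t : 3 ≤ t)
  (bounded : ∀ S v → InducedSubgraphs.deg G S v ≤ M * t)
  (L : Fin n → List ℕ) (L-unique : ∀ v → Unique (L v)) where

  open Graph G
  open InducedSubgraphs G
  open Reductions G t M 3≤t bounded L L-unique

  Reducible : Subset n → Set
  Reducible S = (∀ T → size T < size S → Colouring T) → Colouring S

  reduce-by-placing : ∀ {S v} → v ∈ˢ S → (∀ c → Forested t (S - v) c → Placement S c v) → Reducible S
  reduce-by-placing {S} {v} v∈S place smaller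
    with c , good , listed ← smaller (S - v) (x∈p⇒∣p-x∣<∣p∣ v∈S) = placed listed (place c good)

  reduce-pendant : ∀ {S v} → v ∈ˢ S → deg S v ≤ 1 → 1 ≤ M → M < length (L v) → Reducible S
  reduce-pendant {S} {v} v∈S deg≤1 1≤M M<L = reduce-by-placing v∈S place
    where
    place : ∀ c → Forested t (S - v) c → Placement S c v
    place c good with nbrs S v in eq
    ... | [] with a , a∈ , a∉ ← pick (c v ∷ []) (L-unique v) (≤-<-trans 1≤M M<L) =
      a , a∈ , place₁ v∈S good (c v ∷ [])
        (λ {x} x∈S v~x → contradiction (subst (x ∈_) eq (∈-nbrs⁺ x∈S v~x)) λ ())
        (here refl) a∈ a∉ (λ v~v → contradiction v~v (~-irrefl refl))
    ... | u ∷ [] with a , a∈ , a∉ ← pick (c u ∷ saturated (S - v) c v u) (L-unique v)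
                      (≤-<-trans (saturated-after-deletion v∈S (proj₂ (∈-nbrs⁻ (subst (u ∈_) (sym eq) (here refl)))) c) M<L) =
      a , a∈ , place₁ v∈S good (c u ∷ saturated (S - v) c v u)
        (λ {x} x∈S v~x → only (subst (x ∈_) eq (∈-nbrs⁺ x∈S v~x)))
        (here refl) a∈ a∉ (λ _ → a∉ ∘ there)
      where
      only : ∀ {x} → x ∈ u ∷ [] → x ≡ u
      only (here x≡u) = x≡u
    ... | _ ∷ _ ∷ _ = contradiction deg≤1 λ { (s≤s ()) }

  -- The budget of `place-low-degree` is `suc e` plus at most `M - 1` saturated colours at the other
  -- neighbour, `M + e` in total.
  reduce-2-vertex : ∀ {S v u} e → v ∈ˢ S → u ∈ˢ S → v ~ u → deg S v ≡ 2 → deg S u ≤ suc e →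
    1 ≤ e → e < t → M + e < length (L v) → Reducible S
  reduce-2-vertex {S} {v} e v∈S u∈S v~u deg≡2 deg≤ 1≤e e<t short
    with w , two ← otherNeighbour deg≡2 u∈S v~u = reduce-by-placing v∈S λ c good →
      place-low-degree v∈S two good deg≤ 1≤e e<t (≤-<-trans
        (begin
          suc (e + length (saturated (S - v) c v w))  ≡⟨ +-suc e _ ⟨
          e + suc (length (saturated (S - v) c v w))  ≤⟨ +-monoʳ-≤ e (saturated-after-deletion v∈S (TwoNeighbours.v~w two) c) ⟩
          e + M                                       ≡⟨ +-comm e M ⟩
          M + e                                       ∎)
        short)
    where open ≤-Reasoning

  -- `w` keeps at most two neighbours, fewer than `t`, so nothing is saturated there and two
  -- forbidden colours remain.
  reduce-2-2-3 : ∀ {S v u w} → v ∈ˢ S → TwoNeighbours S v u w → deg S u ≤ 2 → deg S w ≤ 3 →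
    3 ≤ length (L v) → Reducible S
  reduce-2-2-3 {S} {v} {u} {w} v∈S two degu degw 3≤L = reduce-by-placing v∈S λ c good →
    place-low-degree v∈S two good degu ≤-refl (≤-trans (s≤s (s≤s z≤n)) 3≤t)
      (≤-trans (s≤s (s≤s (few-saturated (S - v) c v w {1}
        (≤-trans (≤-trans (deg-delete v∈S (~-sym (TwoNeighbours.v~w two))) degw)
                 (≤-trans 3≤t (≤-reflexive (sym (*-identityˡ t)))))))) 3≤L)

  reduce-2-3-5 : ∀ {S v u w} → v ∈ˢ S → TwoNeighbours S v u w → deg S u ≤ 3 → deg S w ≤ 5 →
    4 ≤ length (L v) → Reducible S
  reduce-2-3-5 v∈S two degu degw 4≤L = reduce-by-placing v∈S λ c good →
    place-3-5 v∈S two good degu degw 4≤L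

  deleteAll : Subset n → List (Fin n) → Subset n
  deleteAll S []       = S
  deleteAll S (v ∷ vs) = deleteAll S vs - v

  ∈-deleteAll⁺ : ∀ {S x} vs → x ∈ˢ S → x ∉ vs → x ∈ˢ deleteAll S vs
  ∈-deleteAll⁺ []       x∈S _  = x∈S
  ∈-deleteAll⁺ (v ∷ vs) x∈S x∉ = x∈p∧x≢y⇒x∈p-y (∈-deleteAll⁺ vs x∈S (x∉ ∘ there)) (x∉ ∘ here)

  ∈-deleteAll⁻ : ∀ {S x} vs → x ∈ˢ deleteAll S vs → x ∈ˢ S × x ∉ vs
  ∈-deleteAll⁻ []       x∈ = x∈ , λ ()
  ∈-deleteAll⁻ (v ∷ vs) x∈ with x∈vs , x≢v ← ∈-delete⁻ x∈ with x∈S , x∉ ← ∈-deleteAll⁻ vs x∈vs =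
    x∈S , λ { (here x≡v) → x≢v x≡v ; (there x∈vs) → x∉ x∈vs }

  -- Provides the one neighbour of the centre of a star that survives when the chosen 2-neighbours
  -- are deleted.
  leftover : ∀ {xs ys : List (Fin n)} → Unique xs → Unique ys → (∀ {x} → x ∈ xs → x ∈ ys) →
    length ys ≡ suc (length xs) → ∃[ y ] y ∈ ys × y ∉ xs × (∀ {z} → z ∈ ys → z ≡ y ⊎ z ∈ xs)
  leftover {xs} {ys} uxs uys xs⊆ys len = from (filter (λ y → ¬? (y ∈? xs)) ys) refl
    where
    open DecMembership (Fin._≟_ {n}) using (_∈?_)
    rest = filter (λ y → ¬? (y ∈? xs)) ys
    common≡ : length (filter (_∈? xs) ys) ≡ length xs
    common≡ = ≤-antisym
      (unique-⊆⇒length-≤ (Unique.filter⁺ (_∈? xs) uys) (λ z∈ → proj₂ (∈-filter⁻ (_∈? xs) {xs = ys} z∈)))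
      (unique-⊆⇒length-≤ uxs (λ z∈ → ∈-filter⁺ (_∈? xs) (xs⊆ys z∈) z∈))
    rest≡1 : length rest ≡ 1
    rest≡1 = +-cancelˡ-≡ (length xs) _ _ (begin
      length xs + length rest                       ≡⟨ cong (_+ length rest) common≡ ⟨
      length (filter (_∈? xs) ys) + length rest     ≡⟨ length-filter+filter-∁ (_∈? xs) ys ⟩
      length ys                                     ≡⟨ len ⟩
      suc (length xs)                               ≡⟨ +-comm 1 _ ⟩
      length xs + 1                                 ∎)
      where open ≡-Reasoning
    from : ∀ zs → zs ≡ rest → ∃[ y ] y ∈ ys × y ∉ xs × (∀ {z} → z ∈ ys → z ≡ y ⊎ z ∈ xs)
    from [] eq = contradiction (trans (cong length eq) rest≡1) λ ()
    from (y ∷ z ∷ zs) eq = contradiction (trans (cong length eq) rest≡1) λ ()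
    from (y ∷ []) eq = y , y∈ys , y∉xs , only
      where
      y∈ = ∈-filter⁻ (λ y → ¬? (y ∈? xs)) {xs = ys} (subst (y ∈_) eq (here refl))
      y∈ys = proj₁ y∈
      y∉xs = proj₂ y∈
      only : ∀ {z} → z ∈ ys → z ≡ y ⊎ z ∈ xs
      only {z} z∈ys with z ∈? xs
      ... | yes z∈xs = inj₂ z∈xs
      ... | no  z∉xs with subst (z ∈_) (sym eq) (∈-filter⁺ (λ y → ¬? (y ∈? xs)) z∈ys z∉xs)
      ...   | here z≡y = inj₁ z≡y

  -- Delete u together with its 2-neighbours vs.  The colour chosen for u is the
  -- colour of the far end of at most one vertex in vs, so that no bicoloured
  -- cycle can pass through two vertices of vs.
  module _ {S : Subset n} {u : Fin n} {vs : List (Fin n)}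
    (centre∈S : u ∈ˢ S) (vs-unique : Unique vs)
    (vs-nbrs : ∀ {v} → v ∈ vs → v ∈ nbrs S u)
    (vs-deg : ∀ {v} → v ∈ vs → deg S v ≡ 2)
    (independent : ∀ {v w} → v ∈ vs → w ∈ˢ S → v ~ w → deg S w ≢ 2)
    (deg-u : deg S u ≡ suc (length vs)) (vs≤5 : length vs ≤ 5)
    (long : ∀ v → M + 2 < length (L v)) where

    private
      open DecMembership (Fin._≟_ {n}) using (_∈?_)

      vs∈S : ∀ {v} → v ∈ vs → v ∈ˢ S
      vs∈S v∈ = proj₁ (∈-nbrs⁻ (vs-nbrs v∈))

      vs~u : ∀ {v} → v ∈ vs → v ~ u
      vs~u v∈ = ~-sym (proj₂ (∈-nbrs⁻ (vs-nbrs v∈)))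

      far : ∀ {v} → v ∈ vs → ∃[ w ] TwoNeighbours S v u w
      far v∈ = otherNeighbour (vs-deg v∈) centre∈S (vs~u v∈)

      farEnd : Fin n → Fin n
      farEnd v with v ∈? vs
      ... | yes v∈ = proj₁ (far v∈)
      -- Arbitrary value; `farEnd` is only consulted on `vs`.
      ... | no  _  = u

      farEnd-two : ∀ {v} → v ∈ vs → TwoNeighbours S v u (farEnd v)
      farEnd-two {v} v∈ with v ∈? vs
      ... | yes v∈′ = proj₂ (far v∈′)
      ... | no  v∉  = contradiction v∈ v∉

      u∉vs : u ∉ vs
      u∉vs u∈ = ~-irrefl refl (vs~u u∈)

      -- Since far ends are never spokes, they keep their colours while the spokes are filled in,
      -- and `Separated` survives.
      farEnd∉vs : ∀ {v} → v ∈ vs → farEnd v ∉ vs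
      farEnd∉vs v∈ w∈ = independent v∈ w∈S v~w (vs-deg w∈)
        where open TwoNeighbours (farEnd-two v∈)

      spare = leftover vs-unique (nbrs-unique S u) vs-nbrs deg-u
      kept : Fin n
      kept = proj₁ spare
      kept∈N = proj₁ (proj₂ spare)
      kept-only = proj₂ (proj₂ (proj₂ spare))

      Separated : (Fin n → ℕ) → Set
      Separated c = ∀ {v v′} → v ∈ vs → v′ ∈ vs → c (farEnd v) ≡ c u → c (farEnd v′) ≡ c u → v ≡ v′

      separated-update : ∀ {c w} a → w ≢ u → (∀ {v} → v ∈ vs → farEnd v ≢ w) →
        Separated c → Separated (c [ w ↦ a ])
      separated-update {c} {w} a w≢u far≢w sep v∈ v′∈ eq eq′ = sep v∈ v′∈ (old v∈ eq) (old v′∈ eq′)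
        where
        old : ∀ {v} → v ∈ vs → (c [ w ↦ a ]) (farEnd v) ≡ (c [ w ↦ a ]) u → c (farEnd v) ≡ c u
        old v∈ eq = trans (sym (update-other c a (far≢w v∈))) (trans eq (update-other c a (≢-sym w≢u)))

      -- The centre keeps at most 5 neighbours, fewer than `2 * t`, hence at most one saturated
      -- colour. Together with `c u`, one free slot `e` and at most `M - 1` saturated colours at the
      -- far end, this forbids at most `M + 2` colours.
      place-spoke : ∀ {T c v} → v ∈ vs → v ∈ˢ T → (∀ {y} → y ∈ˢ T → y ∈ˢ S) →
        (∀ {y} → y ∈ˢ S → y ∉ vs → y ∈ˢ T) →
        Forested t (T - v) c → Separated c → Placement T c v
      place-spoke {T} {c} {v} v∈ v∈T T⊆S keeps good sep = result
        where
        w = farEnd v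
        two : TwoNeighbours T v u w
        two = record
          { u∈S = keeps centre∈S u∉vs ; w∈S = keeps w∈S (farEnd∉vs v∈)
          ; v~u = v~u ; v~w = v~w ; u≢w = u≢w ; only = only ∘ T⊆S }
          where open TwoNeighbours (farEnd-two v∈)
        open TwoNeighbours two
        sat-u = saturated (T - v) c v u
        sat-w = saturated (T - v) c v w
        forbidden : ℕ → List ℕ
        forbidden e = c u ∷ e ∷ sat-u ++ sat-w
        deg-u≤5 : deg (T - v) u ≤ 5
        deg-u≤5 = s≤s⁻¹ (≤-trans (deg-delete v∈T (~-sym v~u))
          (≤-trans (deg-mono u T⊆S) (≤-trans (≤-reflexive deg-u) (s≤s vs≤5))))
        short : ∀ e → length (forbidden e) < length (L v)
        short e = ≤-<-trans (begin
          2 + length (sat-u ++ sat-w)           ≡⟨ cong (2 +_) (length-++ sat-u) ⟩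
          2 + (length sat-u + length sat-w)     ≤⟨ +-monoʳ-≤ 2 (+-monoˡ-≤ (length sat-w) (s≤s⁻¹
                                                     (few-saturated (T - v) c v u {2}
                                                       (≤-<-trans deg-u≤5 (*-monoʳ-≤ 2 3≤t))))) ⟩
          2 + suc (length sat-w)                ≤⟨ +-monoʳ-≤ 2 (saturated-after-deletion v∈T v~w c) ⟩
          2 + M                                 ≡⟨ +-comm 2 M ⟩
          M + 2                                 ∎) (long v)
          where open ≤-Reasoning
        rooms : ∀ {e a} → a ∈ L v → a ∉ forbidden e →
          length (fibre c a (nbrs (T - v) u)) < t × length (fibre c a (nbrs (T - v) w)) < t
        rooms a∈ a∉ = unsaturated {c = c} a∈ (a∉ ∘ there ∘ there ∘ ∈-++⁺ˡ) ,
                      unsaturated {c = c} a∈ (a∉ ∘ there ∘ there ∘ ∈-++⁺ʳ sat-u)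
        result : Placement T c v
        result with c u ℕ.≟ c w
        ... | no cu≢cw = place₂ v∈T two good (forbidden (c w)) (short (c w)) (here refl) (there (here refl))
          λ a∈ a∉ → let ru , rw = rooms a∈ a∉ in ru , rw , λ cu≡cw → contradiction cu≡cw cu≢cw
        -- The slot freed by the coincidence goes to `c kept`. A neighbour of `u` with the new
        -- colour is then another spoke, and by `Separated` its far end does not have the colour of
        -- `u`, since the far end of `v` already does. So `u` is a dead end.
        ... | yes cu≡cw = place₂ v∈T two good (forbidden (c kept)) (short (c kept)) (here refl) (here (sym cu≡cw))
          λ a∈ a∉ → let ru , rw = rooms a∈ a∉ in ru , rw , λ _ → inj₁ (stops (a∉ ∘ there ∘ here))
          where
          stops : ∀ {a} → a ≢ c kept → DeadEnd (T - v) c a u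
          stops a≢cx {y} {z} y∈ z∈ u~y refl y~z z≢u cz≡cu with ∈-delete⁻ y∈
          ... | y∈T , y≢v with kept-only (∈-nbrs⁺ (T⊆S y∈T) u~y)
          ...   | inj₁ refl = a≢cx refl
          ...   | inj₂ y∈vs with TwoNeighbours.only (farEnd-two y∈vs) (T⊆S (proj₁ (∈-delete⁻ z∈))) y~z
          ...     | inj₁ z≡u  = z≢u z≡u
          ...     | inj₂ refl = y≢v (sep y∈vs v∈ cz≡cu (sym cu≡cw))

      fill : ∀ todo → (∀ {v} → v ∈ todo → v ∈ vs) → Unique todo →
        ∀ c → Forested t (deleteAll S todo) c → (∀ {v} → v ∈ˢ deleteAll S todo → c v ∈ L v) →
        Separated c → Colouring S
      fill [] _ _ c good listed _ = c , good , listed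
      fill (v ∷ todo) todo⊆vs (v∉ ∷ unique) c good listed sep
        with a , a∈ , good′ ← place-spoke (todo⊆vs (here refl))
               (∈-deleteAll⁺ todo (vs∈S (todo⊆vs (here refl))) (λ v∈ → All.lookup v∉ v∈ refl))
               (proj₁ ∘ ∈-deleteAll⁻ todo)
               (λ y∈S y∉vs → ∈-deleteAll⁺ todo y∈S (y∉vs ∘ todo⊆vs ∘ there))
               good sep =
        fill todo (todo⊆vs ∘ there) unique (c [ v ↦ a ]) good′ (extend-list listed a∈)
          (separated-update {c = c} a (λ { refl → u∉vs v∈vs }) (λ { v′∈ refl → farEnd∉vs v′∈ v∈vs }) sep)
        where v∈vs = todo⊆vs (here refl)

    reduce-star : Reducible S
    reduce-star smaller = finish (smaller (deleteAll S vs - u)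
      (<-≤-trans (x∈p⇒∣p-x∣<∣p∣ u∈rim) (p⊆q⇒∣p∣≤∣q∣ (proj₁ ∘ ∈-deleteAll⁻ vs))))
      where
      u∈rim : u ∈ˢ deleteAll S vs
      u∈rim = ∈-deleteAll⁺ vs centre∈S u∉vs
      -- After the deletions `kept` is the only neighbour of `u`. Colours on two or more far ends
      -- are forbidden too; with at most five spokes there are at most two of them, so the total is
      -- at most `1 + (M - 1) + 2 = M + 2`.
      hub : (Fin n → ℕ) → List ℕ
      hub c = c kept ∷ saturated (deleteAll S vs - u) c u kept ++ frequent 2 (c ∘ farEnd) vs (L u)
      hub-short : ∀ c → length (hub c) < length (L u)
      hub-short c = ≤-<-trans (begin
        suc (length (sat ++ often))         ≡⟨ cong suc (length-++ sat) ⟩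
        suc (length sat) + length often     ≤⟨ +-mono-≤ (saturated-after-deletion u∈rim (proj₂ (∈-nbrs⁻ kept∈N)) c)
                                                 (s≤s⁻¹ (*-cancelʳ-< 2 (length often) 3 (s≤s (≤-trans (length-frequent 2 (c ∘ farEnd) vs (L-unique u)) vs≤5)))) ⟩
        M + 2                               ∎) (long u)
        where
        open ≤-Reasoning
        sat   = saturated (deleteAll S vs - u) c u kept
        often = frequent 2 (c ∘ farEnd) vs (L u)
      old : ∀ c {a v} → v ∈ vs → (c [ u ↦ a ]) (farEnd v) ≡ (c [ u ↦ a ]) u → c (farEnd v) ≡ a
      old c {a} v∈ eq = trans (sym (update-other c a (≢-sym (TwoNeighbours.u≢w (farEnd-two v∈)))))
        (trans eq (update-same c u a))
      separated : ∀ c {a} → a ∈ L u → a ∉ frequent 2 (c ∘ farEnd) vs (L u) →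
        ∀ {v v′} → v ∈ vs → v′ ∈ vs → c (farEnd v) ≡ a → c (farEnd v′) ≡ a → v ≡ v′
      separated c {a} a∈ a∉ {v} {v′} v∈ v′∈ eq eq′ with v Fin.≟ v′
      ... | yes v≡v′ = v≡v′
      ... | no  v≢v′ = contradiction (∉-frequent 2 (c ∘ farEnd) vs a∈ a∉) (≤⇒≯
        (unique-⊆⇒length-≤ {xs = v ∷ v′ ∷ []} ((v≢v′ ∷ []) ∷ [] ∷ [])
          λ { (here refl) → ∈-filter⁺ (λ y → c (farEnd y) ℕ.≟ a) v∈ eq
            ; (there (here refl)) → ∈-filter⁺ (λ y → c (farEnd y) ℕ.≟ a) v′∈ eq′ }))
      finish : Colouring (deleteAll S vs - u) → Colouring S
      finish (c , good , listed) with a , a∈ , a∉ ← pick (hub c) (L-unique u) (hub-short c) =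
        fill vs id vs-unique (c [ u ↦ a ])
          (place₁ u∈rim good (hub c)
            (λ y∈ u~y → let y∈S , y∉vs = ∈-deleteAll⁻ vs y∈ in
               [ id , (λ y∈vs → contradiction y∈vs y∉vs) ]′ (kept-only (∈-nbrs⁺ y∈S u~y)))
            (here refl) a∈ a∉ (λ _ → a∉ ∘ there ∘ ∈-++⁺ˡ))
          (extend-list listed a∈)
          (λ v∈ v′∈ eq eq′ → separated c a∈ (a∉ ∘ there ∘ ∈-++⁺ʳ (saturated (deleteAll S vs - u) c u kept))
             v∈ v′∈ (old c v∈ eq) (old c v′∈ eq′))

-- Maximum average degree and discharging

-- Rationals are stored in lowest terms, so cross-multiplication goes through the unnormalised ones.
/-cancel-< : ∀ a d p r → (ℤ.+ a) ℚ./ suc d ℚ.< (ℤ.+ p) ℚ./ suc r → a * suc r < p * suc d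
/-cancel-< a d p r lt = ℤ.drop‿+<+ (subst₂ ℤ._<_ (sym (ℤ.pos-* a (suc r))) (sym (ℤ.pos-* p (suc d)))
  (ℚᵘ.drop-*<* (ℚᵘ.<-respˡ-≃ (ℚ.toℚᵘ-fromℚᵘ (ℚᵘ.mkℚᵘ (ℤ.+ a) d))
    (ℚᵘ.<-respʳ-≃ (ℚ.toℚᵘ-fromℚᵘ (ℚᵘ.mkℚᵘ (ℤ.+ p) r)) (ℚ.toℚᵘ-mono-< lt)))))

∈-allSubsets : ∀ {n} (S : Subset n) → S ∈ allSubsets n
∈-allSubsets Vec.[]              = here refl
∈-allSubsets (outside Vec.∷ S) = ∈-++⁺ˡ (∈-map⁺ (outside Vec.∷_) (∈-allSubsets S))
∈-allSubsets {suc n} (inside  Vec.∷ S) =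
  ∈-++⁺ʳ (map (outside Vec.∷_) (allSubsets n)) (∈-map⁺ (inside Vec.∷_) (∈-allSubsets S))

fromPred : ∀ {m} {P : Pred (Fin m) 0ℓ} → Decidable P → Subset m
fromPred P? = Vec.tabulate (λ i → does (P? i))

module _ {m : ℕ} {P : Pred (Fin m) 0ℓ} (P? : Decidable P) where

  ∈-fromPred⁺ : ∀ {i} → P i → i ∈ˢ fromPred P?
  ∈-fromPred⁺ {i} pi = lookup⇒[]= i _ (trans (lookup∘tabulate (λ i → does (P? i)) i) (dec-true (P? i) pi))

  ∈-fromPred⁻ : ∀ {i} → i ∈ˢ fromPred P? → P i
  ∈-fromPred⁻ {i} i∈ with P? i | trans (sym ([]=⇒lookup i∈)) (lookup∘tabulate (λ i → does (P? i)) i)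
  ... | yes pi | _ = pi
  ... | no  _  | ()

module Sparse {n : ℕ} (G : Graph n) where

  open Graph G
  open InducedSubgraphs G

  deg≤maxDegree : ∀ S v → deg S v ≤ maxDegree G
  deg≤maxDegree S v = ≤-trans
    (unique-⊆⇒length-≤ (nbrs-unique S v) λ x∈ →
      ∈-filter⁺ (v ~?_) (∈-allFin _) (proj₂ (∈-nbrs⁻ x∈)))
    (All.lookup (xs≤maxℕ 0 (map (degree G) (allFin n))) (∈-map⁺ (degree G) (∈-allFin v)))

  size≤ : ∀ S → size S ≤ length (elements S)
  size≤ S = ≤-trans (p⊆q⇒∣p∣≤∣q∣ (∈-fromPred⁺ (_∈ˢ? S)))
    (≤-reflexive (sym (length-filter-tabulate (_∈ˢ? S) id)))

  within? : ∀ S → Decidable (λ (e : Fin n × Fin n) → proj₁ e ∈ˢ S × proj₂ e ∈ˢ S)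
  within? S (u , v) = (u ∈ˢ? S) ×-dec (v ∈ˢ? S)

  inducedEdges : Subset n → List (Fin n × Fin n)
  inducedEdges S = filter (within? S) (edges G)

  -- Handshaking: an ordered adjacent pair is a listed edge or the reverse of one.
  ∑deg≤ : ∀ S → ∑⟨ elements S ⟩ (deg S) ≤ 2 * length (inducedEdges S)
  ∑deg≤ S = begin
    ∑⟨ elements S ⟩ (deg S)                         ≡⟨ length-filter-cartesianProduct adjacent? (elements S) (elements S) ⟨
    length pairs                                    ≤⟨ unique-⊆⇒length-≤
                                                         (Unique.filter⁺ adjacent? (Unique.cartesianProduct⁺ (elements-unique S) (elements-unique S)))
                                                         oriented ⟩
    length (E ++ map swap E)                        ≡⟨ length-++ E ⟩
    length E + length (map swap E)                  ≡⟨ cong (length E +_) (length-map swap E) ⟩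
    length E + length E                             ≡⟨ cong (length E +_) (+-identityʳ (length E)) ⟨
    2 * length E                                    ∎
    where
    open ≤-Reasoning
    E = inducedEdges S
    adjacent? : Decidable (λ (e : Fin n × Fin n) → proj₁ e ~ proj₂ e)
    adjacent? (u , v) = u ~? v
    pairs = filter adjacent? (cartesianProduct (elements S) (elements S))
    edge : ∀ {u v} → u ∈ˢ S → v ∈ˢ S → u Fin.< v → u ~ v → (u , v) ∈ E
    edge u∈ v∈ u<v u~v = ∈-filter⁺ (within? S) (∈-filter⁺ (λ (u , v) → (u Fin.<? v) ×-dec (u ~? v))
      (∈-cartesianProduct⁺ (∈-allFin _) (∈-allFin _)) (u<v , u~v)) (u∈ , v∈)
    oriented : ∀ {e} → e ∈ pairs → e ∈ E ++ map swap E
    oriented {u , v} e∈ with ∈-filter⁻ adjacent? {xs = cartesianProduct (elements S) (elements S)} e∈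
    ... | uv∈ , u~v with ∈-cartesianProduct⁻ (elements S) (elements S) uv∈
    ...   | u∈ , v∈ with Fin.<-cmp u v
    ...     | tri< u<v _ _ = ∈-++⁺ˡ (edge (∈-elements⁻ u∈) (∈-elements⁻ v∈) u<v u~v)
    ...     | tri≈ _ u≡v _ = contradiction u≡v (~⇒≢ u~v)
    ...     | tri> _ _ v<u = ∈-++⁺ʳ E (∈-map⁺ swap (edge (∈-elements⁻ v∈) (∈-elements⁻ u∈) v<u (~-sym u~v)))

  average≤mad : ∀ S → (2 * length (inducedEdges S)) ÷ size S ℚ.≤ mad G
  average≤mad S = subst (λ m → (2 * m) ÷ size S ℚ.≤ mad G) size-F
    (All.lookup (xs≤maxℚ ℚ.0ℚ (map average subgraphs)) (∈-map⁺ average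
      (∈-filter⁺ (λ (W , F) → isSubgraph? G W F)
        (∈-cartesianProduct⁺ (∈-allSubsets S) (∈-allSubsets F))
        λ e e∈F → ∈-fromPred⁻ (within? S ∘ lookup (edges G)) e∈F)))
    where
    average : Subset n × Subset (length (edges G)) → ℚ.ℚ
    average (W , F) = (2 * size F) ÷ size W
    subgraphs = filter (λ (W , F) → isSubgraph? G W F)
      (cartesianProduct (allSubsets n) (allSubsets (length (edges G))))
    F = fromPred (within? S ∘ lookup (edges G))
    size-F : size F ≡ length (inducedEdges S)
    size-F = trans (sym (length-filter-tabulate (within? S) (lookup (edges G))))
      (cong (length ∘ filter (within? S)) (tabulate-lookup (edges G)))

  mad⇒∑deg< : ∀ p r {S v} → mad G ℚ.< (ℤ.+ p) ℚ./ suc r → v ∈ˢ S →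
    suc r * ∑⟨ elements S ⟩ (deg S) < p * length (elements S)
  mad⇒∑deg< p r {S} {v} mad< v∈S with size S in eq | average≤mad S
  -- `v` lies in `S`, so the value that `÷` assigns to a zero denominator never occurs.
  ... | zero  | _   = contradiction (≤-trans (x∈p⇒∣p-x∣<∣p∣ v∈S) (≤-reflexive eq)) λ ()
  ... | suc d | le  = begin-strict
    suc r * ∑⟨ elements S ⟩ (deg S)      ≤⟨ *-monoʳ-≤ (suc r) (∑deg≤ S) ⟩
    suc r * (2 * length (inducedEdges S)) ≡⟨ *-comm (suc r) _ ⟩
    2 * length (inducedEdges S) * suc r  <⟨ /-cancel-< (2 * length (inducedEdges S)) d p r (ℚ.≤-<-trans le mad<) ⟩
    p * suc d                            ≡⟨ cong (p *_) eq ⟨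
    p * size S                           ≤⟨ *-monoʳ-≤ p (size≤ S) ⟩
    p * length (elements S)              ∎
    where open ≤-Reasoning

  -- Charges are multiplied by `suc r` to stay in the naturals. Since `out` and `into` have equal
  -- totals, final charges of at least `p` everywhere would push the average degree up to
  -- `p / suc r`.
  discharge : ∀ p r {S v} → mad G ℚ.< (ℤ.+ p) ℚ./ suc r → v ∈ˢ S → (out into : Fin n → ℕ) →
    ∑⟨ elements S ⟩ out ≡ ∑⟨ elements S ⟩ into →
    ¬ (∀ {v} → v ∈ˢ S → p + out v ≤ suc r * deg S v + into v)
  discharge p r {S} mad< v∈S out into balance ok = <⇒≱ (mad⇒∑deg< p r mad< v∈S)
    (+-cancelʳ-≤ (∑⟨ elements S ⟩ out) _ _ (begin
      p * length (elements S) + ∑⟨ elements S ⟩ out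
        ≡⟨ cong (_+ ∑⟨ elements S ⟩ out) (trans (*-comm p _) (sym (∑-const (elements S) p))) ⟩
      ∑⟨ elements S ⟩ (λ _ → p) + ∑⟨ elements S ⟩ out
        ≡⟨ ∑-+ (elements S) (λ _ → p) out ⟨
      ∑⟨ elements S ⟩ (λ v → p + out v)
        ≤⟨ ∑-mono (elements S) (ok ∘ ∈-elements⁻) ⟩
      ∑⟨ elements S ⟩ (λ v → suc r * deg S v + into v)
        ≡⟨ ∑-+ (elements S) (λ v → suc r * deg S v) into ⟩
      ∑⟨ elements S ⟩ (λ v → suc r * deg S v) + ∑⟨ elements S ⟩ into
        ≡⟨ cong₂ _+_ (∑-* (elements S) (suc r) (deg S)) (sym balance) ⟩
      suc r * ∑⟨ elements S ⟩ (deg S) + ∑⟨ elements S ⟩ out ∎))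
    where open ≤-Reasoning

  -- Conservation of charge when each `v` sends `h v` to every neighbour: total sent on the left,
  -- total received on the right.
  ∑-nbrs : ∀ S (h : Fin n → ℕ) →
    ∑⟨ elements S ⟩ (λ v → deg S v * h v) ≡ ∑⟨ elements S ⟩ (λ v → ∑⟨ nbrs S v ⟩ h)
  ∑-nbrs S h = sym (trans (∑-filter-swap _~?_ (λ _ → h) (elements S) (elements S))
    (∑-cong (elements S) λ {u} _ → trans (∑-const (filter (flip _~?_ u) (elements S)) (h u))
      (cong (λ xs → length xs * h u) (filter-≐ (flip _~?_ u) (u ~?_) (~-sym , ~-sym) (elements S)))))

-- Discharging rules and the three colouring results

∑-indicator : ∀ {A : Set} {P : Pred A 0ℓ} (P? : Decidable P) xs →
  ∑⟨ xs ⟩ (λ x → if does (P? x) then 1 else 0) ≡ length (filter P? xs)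
∑-indicator P? [] = refl
∑-indicator P? (x ∷ xs) with does (P? x)
... | true  = cong suc (∑-indicator P? xs)
... | false = ∑-indicator P? xs

-- A constructive replacement for the case split on whether some vertex is reducible.
all-or : ∀ {n} {A : Set} {P : Fin n → Set} → (∀ v → A ⊎ P v) → A ⊎ (∀ v → P v)
all-or {zero}  f = inj₂ λ ()
all-or {suc n} f with f zero | all-or (f ∘ suc)
... | inj₁ a | _      = inj₁ a
... | inj₂ _ | inj₁ a = inj₁ a
... | inj₂ p | inj₂ ps = inj₂ λ { zero → p ; (suc v) → ps v }

∑-pair : ∀ {A : Set} (f : A → ℕ) {xs u w} → xs ≡ u ∷ w ∷ [] → ∑⟨ xs ⟩ f ≡ f u + f w
∑-pair f {u = u} {w} refl = cong (f u +_) (+-identityʳ (f w))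

∈-take : ∀ {A : Set} m {xs : List A} {x} → x ∈ List.take m xs → x ∈ xs
∈-take m {xs} x∈ = subst (_ ∈_) (take++drop≡id m xs) (∈-++⁺ˡ x∈)

-- Under mad < 12/5 a vertex of degree d sends charge₁ d / 5 to each neighbour.
charge₁ : ℕ → ℕ
charge₁ (suc (suc (suc zero)))    = 1
charge₁ (suc (suc (suc (suc _)))) = 2
charge₁ _                         = 0

charge₁-3 : ∀ {d} → 3 ≤ d → 1 ≤ charge₁ d
charge₁-3 {3}                    _ = s≤s z≤n
charge₁-3 {suc (suc (suc (suc _)))} _ = s≤s z≤n
charge₁-3 {1} (s≤s ())
charge₁-3 {2} (s≤s (s≤s ()))

charge₁-4 : ∀ {d} → 4 ≤ d → 2 ≤ charge₁ d
charge₁-4 (s≤s (s≤s (s≤s (s≤s _)))) = ≤-refl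

-- Under mad < 8/3 a vertex of degree d sends charge₂ d / 9 to each neighbour.
charge₂ : ℕ → ℕ
charge₂ 3 = 1
charge₂ 4 = 3
charge₂ 5 = 3
charge₂ (suc (suc (suc (suc (suc (suc _)))))) = 5
charge₂ _ = 0

charge₂-3 : ∀ {d} → 3 ≤ d → 1 ≤ charge₂ d
charge₂-3 {1} (s≤s ())
charge₂-3 {2} (s≤s (s≤s ()))
charge₂-3 {3} _ = s≤s z≤n
charge₂-3 {4} _ = s≤s z≤n
charge₂-3 {5} _ = s≤s z≤n
charge₂-3 {suc (suc (suc (suc (suc (suc _)))))} _ = s≤s z≤n

charge₂-4 : ∀ {d} → 4 ≤ d → 3 ≤ charge₂ d
charge₂-4 {1} (s≤s ())
charge₂-4 {2} (s≤s (s≤s ()))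
charge₂-4 {3} (s≤s (s≤s (s≤s ())))
charge₂-4 {4} _ = ≤-refl
charge₂-4 {5} _ = ≤-refl
charge₂-4 {suc (suc (suc (suc (suc (suc _)))))} _ = s≤s (s≤s (s≤s z≤n))

charge₂-6 : ∀ {d} → 6 ≤ d → 5 ≤ charge₂ d
charge₂-6 (s≤s (s≤s (s≤s (s≤s (s≤s (s≤s _)))))) = ≤-refl

module Discharging {n : ℕ} (G : Graph n) (t M : ℕ) (3≤t : 3 ≤ t) (2≤M : 2 ≤ M)
  (bounded : ∀ S v → InducedSubgraphs.deg G S v ≤ M * t)
  (L : Fin n → List ℕ) (L-unique : ∀ v → Unique (L v)) where

  open Graph G
  open InducedSubgraphs G
  open Sparse G
  open Reductions G t M 3≤t bounded L L-unique
  open ReducibleConfigurations G t M 3≤t bounded L L-unique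

  colour-all : (∀ {S v} → v ∈ˢ S → Reducible S) → ∀ S → Colouring S
  colour-all reducible S = go S (<-wellFounded (size S))
    where
    go : ∀ S → Acc _<_ (size S) → Colouring S
    go S (acc rec) with nonempty? S
    ... | yes (v , v∈S) = reducible v∈S λ T T<S → go T (rec T<S)
    ... | no  empty     = (λ _ → 0) , record
      { proper  = λ u∈S _ _ → contradiction (_ , u∈S) empty
      ; sparse  = λ v∈S _ → contradiction (_ , v∈S) empty
      ; acyclic = λ (_ , _ , _ , on-S) → contradiction (_ , proj₁ (on-S zero)) empty
      } , λ v∈S → contradiction (_ , v∈S) empty

  all-vertices : ∀ {S} {A : Set} {P : Fin n → Set} → (∀ {v} → v ∈ˢ S → A ⊎ P v) →
    A ⊎ (∀ v → v ∈ˢ S → P v)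
  all-vertices {S} {A} {P} f with all-or {P = λ v → v ∈ˢ S → P v} local
    where
    local : ∀ v → A ⊎ (v ∈ˢ S → P v)
    local v with v ∈ˢ? S
    ... | yes v∈S = [ inj₁ , (λ p → inj₂ λ _ → p) ]′ (f v∈S)
    ... | no  v∉S = inj₂ λ v∈S → contradiction v∈S v∉S
  ... | inj₁ a  = inj₁ a
  ... | inj₂ ps = inj₂ ps

  reducible-by-discharging : ∀ p r {S v} → mad G ℚ.< (ℤ.+ p) ℚ./ suc r → v ∈ˢ S →
    (out into : Fin n → ℕ) → ∑⟨ elements S ⟩ out ≡ ∑⟨ elements S ⟩ into →
    (∀ {v} → v ∈ˢ S → Reducible S ⊎ (p + out v ≤ suc r * deg S v + into v)) → Reducible S
  reducible-by-discharging p r mad< v∈S out into balance local =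
    [ id , (λ ok → contradiction (λ {v} → ok v) (discharge p r mad< v∈S out into balance)) ]′ (all-vertices local)

  module _ (mad< : mad G ℚ.< (ℤ.+ 12) ℚ./ 5) (L-length : ∀ v → length (L v) ≡ M + 1) where

    private
      3≤L : ∀ v → 3 ≤ length (L v)
      3≤L v = ≤-trans (+-monoˡ-≤ 1 2≤M) (≤-reflexive (sym (L-length v)))

      M<L : ∀ v → M < length (L v)
      M<L v = ≤-reflexive (trans (+-comm 1 M) (sym (L-length v)))

      -- In fifths, vertices of degree 3 and 4 give away exactly their surplus over 12, and larger
      -- ones less. A 2-vertex lacks 2, covered by one neighbour of degree at least 4 or by two of
      -- degree at least 3.
      local : ∀ {S v} → v ∈ˢ S → Reducible S ⊎
        (12 + deg S v * charge₁ (deg S v) ≤ 5 * deg S v + ∑⟨ nbrs S v ⟩ (charge₁ ∘ deg S))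
      local {S} {v} v∈S with deg S v in eq
      ... | 0 = inj₁ (reduce-pendant v∈S (≤-trans (≤-reflexive eq) z≤n) (≤-trans (s≤s z≤n) 2≤M) (M<L v))
      ... | 1 = inj₁ (reduce-pendant v∈S (≤-reflexive eq) (≤-trans (s≤s z≤n) 2≤M) (M<L v))
      ... | 3 = inj₂ (m≤m+n 15 _)
      ... | suc (suc (suc (suc d))) = inj₂ (≤-trans
        (≤-trans (m≤m+n _ (3 * d)) (≤-reflexive (solve 1 (λ d →
          con 12 :+ (con 4 :+ d) :* con 2 :+ con 3 :* d := con 5 :* (con 4 :+ d)) refl d)))
        (m≤m+n (5 * (4 + d)) _))
        where open +-*-Solver
      ... | 2 with u , w , two , nbrs≡ ← twoNeighbours eq =
        [ inj₁ , (λ 2≤ → inj₂ (+-monoʳ-≤ 10 (≤-trans 2≤ (≤-reflexive (sym (∑-pair (charge₁ ∘ deg S) nbrs≡)))))) ]′ pays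
        where
        pays : Reducible S ⊎ 2 ≤ charge₁ (deg S u) + charge₁ (deg S w)
        pays with 4 ≤? deg S u | 4 ≤? deg S w
        ... | yes 4≤u | _       = inj₂ (≤-trans (charge₁-4 4≤u) (m≤m+n _ _))
        ... | no  _   | yes 4≤w = inj₂ (≤-trans (charge₁-4 4≤w) (m≤n+m _ _))
        ... | no  u<4 | no  w<4 with 3 ≤? deg S u | 3 ≤? deg S w
        ...   | no  u<3 | _       = inj₁ (reduce-2-2-3 v∈S two (s≤s⁻¹ (≰⇒> u<3)) (s≤s⁻¹ (≰⇒> w<4)) (3≤L v))
        ...   | yes _   | no  w<3 = inj₁ (reduce-2-2-3 v∈S (swapped two) (s≤s⁻¹ (≰⇒> w<3)) (s≤s⁻¹ (≰⇒> u<4)) (3≤L v))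
        ...   | yes 3≤u | yes 3≤w = inj₂ (+-mono-≤ (charge₁-3 3≤u) (charge₁-3 3≤w))

    colourable₁ : ∀ S → Colouring S
    colourable₁ = colour-all λ {S} v∈S → reducible-by-discharging 12 4 mad< v∈S _ _
      (∑-nbrs S (charge₁ ∘ deg S)) local

  module _ (mad< : mad G ℚ.< (ℤ.+ 8) ℚ./ 3) (L-length : ∀ v → length (L v) ≡ M + 2) where

    private
      4≤L : ∀ v → 4 ≤ length (L v)
      4≤L v = ≤-trans (+-monoˡ-≤ 2 2≤M) (≤-reflexive (sym (L-length v)))

      M+1<L : ∀ v → M + 1 < length (L v)
      M+1<L v = ≤-reflexive (trans (sym (+-suc M 1)) (sym (L-length v)))

      M<L : ∀ v → M < length (L v)
      M<L v = ≤-<-trans (m≤m+n M 1) (M+1<L v)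

      -- In ninths, a 2-vertex lacks 6, paid as `3 + 3` by neighbours of degree at least 4, or as
      -- `1 + 5` when one has degree 3 and the other at least 6. Vertices of degree 3, 4 and 6 give
      -- away exactly their surplus over 24.
      local : ∀ {S v} → v ∈ˢ S → Reducible S ⊎
        (24 + deg S v * charge₂ (deg S v) ≤ 9 * deg S v + ∑⟨ nbrs S v ⟩ (charge₂ ∘ deg S))
      local {S} {v} v∈S with deg S v in eq
      ... | 0 = inj₁ (reduce-pendant v∈S (≤-trans (≤-reflexive eq) z≤n) (≤-trans (s≤s z≤n) 2≤M) (M<L v))
      ... | 1 = inj₁ (reduce-pendant v∈S (≤-reflexive eq) (≤-trans (s≤s z≤n) 2≤M) (M<L v))
      ... | 3 = inj₂ (m≤m+n 27 _)
      ... | 4 = inj₂ (m≤m+n 36 _)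
      ... | 5 = inj₂ (≤-trans (m≤m+n 39 6) (m≤m+n 45 _))
      ... | suc (suc (suc (suc (suc (suc d))))) = inj₂ (≤-trans
        (≤-trans (m≤m+n _ (4 * d)) (≤-reflexive (solve 1 (λ d →
          con 24 :+ (con 6 :+ d) :* con 5 :+ con 4 :* d := con 9 :* (con 6 :+ d)) refl d)))
        (m≤m+n (9 * (6 + d)) _))
        where open +-*-Solver
      ... | 2 with u , w , two , nbrs≡ ← twoNeighbours eq =
        [ inj₁ , (λ 6≤ → inj₂ (+-monoʳ-≤ 18 (≤-trans 6≤ (≤-reflexive (sym (∑-pair (charge₂ ∘ deg S) nbrs≡)))))) ]′ pays
        where
        reduce-2-2 : ∀ {u w} → TwoNeighbours S v u w → deg S u < 3 → Reducible S
        reduce-2-2 two u<3 = reduce-2-vertex 1 v∈S u∈S v~u eq (s≤s⁻¹ u<3) ≤-refl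
          (≤-trans (s≤s (s≤s z≤n)) 3≤t) (M+1<L v)
          where open TwoNeighbours two
        pays : Reducible S ⊎ 6 ≤ charge₂ (deg S u) + charge₂ (deg S w)
        pays with 3 ≤? deg S u | 3 ≤? deg S w
        ... | no  u<3 | _       = inj₁ (reduce-2-2 two (≰⇒> u<3))
        ... | yes _   | no w<3  = inj₁ (reduce-2-2 (swapped two) (≰⇒> w<3))
        ... | yes 3≤u | yes 3≤w with 4 ≤? deg S u | 4 ≤? deg S w
        ...   | yes 4≤u | yes 4≤w = inj₂ (+-mono-≤ (charge₂-4 4≤u) (charge₂-4 4≤w))
        ...   | no  u<4 | _ with 6 ≤? deg S w
        ...     | yes 6≤w = inj₂ (+-mono-≤ (charge₂-3 3≤u) (charge₂-6 6≤w))
        ...     | no  w<6 = inj₁ (reduce-2-3-5 v∈S two (s≤s⁻¹ (≰⇒> u<4)) (s≤s⁻¹ (≰⇒> w<6)) (4≤L v))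
        pays | yes 3≤u | yes 3≤w | yes _ | no w<4 with 6 ≤? deg S u
        ...     | yes 6≤u = inj₂ (+-mono-≤ (charge₂-6 6≤u) (charge₂-3 3≤w))
        ...     | no  u<6 = inj₁ (reduce-2-3-5 v∈S (swapped two) (s≤s⁻¹ (≰⇒> w<4)) (s≤s⁻¹ (≰⇒> u<6)) (4≤L v))

    colourable₂ : ∀ S → Colouring S
    -- `24 / 9` normalises to `8 / 3`, so `mad<` applies as it stands; ninths keep the charges
    -- integral.
    colourable₂ = colour-all λ {S} v∈S → reducible-by-discharging 24 8 mad< v∈S _ _
      (∑-nbrs S (charge₂ ∘ deg S)) local

  module _ (mad< : mad G ℚ.< (ℤ.+ 3) ℚ./ 1) (L-length : ∀ v → length (L v) ≡ M + 3) where

    private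
      M+2<L : ∀ v → M + 2 < length (L v)
      M+2<L v = ≤-reflexive (trans (sym (+-suc M 2)) (sym (L-length v)))

      M<L : ∀ v → M < length (L v)
      M<L v = ≤-<-trans (m≤m+n M 2) (M+2<L v)

      is2? : ∀ S → Decidable (λ v → deg S v ≡ 2)
      is2? S v = deg S v ℕ.≟ 2

      -- Under mad < 3 every vertex sends 1/2 to each 2-neighbour.
      is2 : Subset n → Fin n → ℕ
      is2 S v = if does (is2? S v) then 1 else 0

      2-nbrs : Subset n → Fin n → List (Fin n)
      2-nbrs S v = filter (is2? S) (nbrs S v)

      2-nbrs-unique : ∀ S v → Unique (2-nbrs S v)
      2-nbrs-unique S v = Unique.filter⁺ (is2? S) (nbrs-unique S v)

      ∈-2-nbrs⁻ : ∀ {S v x} → x ∈ 2-nbrs S v → x ∈ nbrs S v × deg S x ≡ 2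
      ∈-2-nbrs⁻ {S} {v} = ∈-filter⁻ (is2? S) {xs = nbrs S v}

      Independent : Subset n → Set
      Independent S = ∀ v → v ∈ˢ S → ∀ w → w ∈ˢ S → v ~ w → deg S v ≡ 2 → 4 ≤ deg S w

      -- Established for the whole of `S` before discharging, because the star reduction needs it at
      -- every spoke.
      independent : ∀ S → Reducible S ⊎ Independent S
      independent S = all-vertices λ v∈S → all-vertices (pair v∈S)
        where
        pair : ∀ {v w} → v ∈ˢ S → w ∈ˢ S → Reducible S ⊎ (v ~ w → deg S v ≡ 2 → 4 ≤ deg S w)
        pair {v} {w} v∈S w∈S with v ~? w | deg S v ℕ.≟ 2 | 4 ≤? deg S w
        ... | no  v≁w | _      | _       = inj₂ λ v~w → contradiction v~w v≁w
        ... | yes _   | no d≢2 | _       = inj₂ λ _ d≡2 → contradiction d≡2 d≢2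
        ... | yes _   | yes _  | yes 4≤w = inj₂ λ _ _ → 4≤w
        ... | yes v~w | yes eq | no  w<4 =
          inj₁ (reduce-2-vertex 2 v∈S w∈S v~w eq (s≤s⁻¹ (≰⇒> w<4)) (s≤s z≤n) 3≤t (M+2<L v))

      -- Just `m` of the 2-neighbours are deleted: if all `suc m` neighbours have degree 2, the last
      -- one is kept like any other neighbour.
      star : ∀ {S u} m → Independent S → u ∈ˢ S → deg S u ≡ suc m → m ≤ 5 →
        m ≤ length (2-nbrs S u) → Reducible S
      star {S} {u} m indep u∈S deg≡ m≤5 m≤ = reduce-star {vs = List.take m (2-nbrs S u)}
        u∈S (Unique.take⁺ m (2-nbrs-unique S u))
        (proj₁ ∘ ∈-2-nbrs⁻ ∘ ∈-take m) (proj₂ ∘ ∈-2-nbrs⁻ ∘ ∈-take m)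
        (λ v∈ w∈S v~w w≡2 → let v∈N , v≡2 = ∈-2-nbrs⁻ (∈-take m v∈) in
          contradiction (≤-trans (indep _ (proj₁ (∈-nbrs⁻ v∈N)) _ w∈S v~w v≡2) (≤-reflexive w≡2)) λ { (s≤s (s≤s ())) })
        (trans deg≡ (cong suc (sym len)))
        (≤-trans (≤-reflexive len) m≤5) M+2<L
        where
        len : length (List.take m (2-nbrs S u)) ≡ m
        len = trans (length-take m (2-nbrs S u)) (m≤n⇒m⊓n≡m m≤)

      no-2-nbrs : ∀ {S v} → Independent S → v ∈ˢ S → deg S v ≤ 3 → length (2-nbrs S v) ≡ 0
      no-2-nbrs {S} {v} indep v∈S deg≤3 = cong length (filter-none (is2? S) (All.tabulate λ x∈ x≡2 →
        let x∈S , v~x = ∈-nbrs⁻ x∈ in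
        contradiction (≤-trans (indep _ x∈S _ v∈S (~-sym v~x) x≡2) deg≤3) λ { (s≤s (s≤s (s≤s ()))) }))

      -- In halves, a 2-vertex lacks 2 and gets 1 from each neighbour. Neighbours of 2-vertices have
      -- degree at least 4; from degree 6 on, `2 * d ≥ 6 + d` pays for all neighbours, and degrees 4
      -- and 5 need the star reduction.
      local : ∀ {S v} → Independent S → v ∈ˢ S → Reducible S ⊎
        (6 + ∑⟨ nbrs S v ⟩ (is2 S) ≤ 2 * deg S v + deg S v * is2 S v)
      local {S} {v} indep v∈S rewrite ∑-indicator (is2? S) (nbrs S v) with deg S v in eq
      ... | 0 = inj₁ (reduce-pendant v∈S (≤-trans (≤-reflexive eq) z≤n) (≤-trans (s≤s z≤n) 2≤M) (M<L v))
      ... | 1 = inj₁ (reduce-pendant v∈S (≤-reflexive eq) (≤-trans (s≤s z≤n) 2≤M) (M<L v))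
      ... | 2 = inj₂ (≤-reflexive (cong (6 +_) (no-2-nbrs indep v∈S (≤-trans (≤-reflexive eq) (s≤s (s≤s z≤n))))))
      ... | 3 = inj₂ (≤-trans (≤-reflexive (cong (6 +_) (no-2-nbrs indep v∈S (≤-reflexive eq)))) (m≤m+n 6 _))
      ... | suc (suc (suc (suc (suc (suc d))))) = inj₂ (≤-trans
        (+-monoʳ-≤ 6 (≤-trans (length-filter (is2? S) (nbrs S v)) (≤-trans (≤-reflexive eq) (m≤m+n (6 + d) d))))
        (≤-trans (≤-reflexive (solve 1 (λ d → con 6 :+ (con 6 :+ d :+ d) := con 2 :* (con 6 :+ d)) refl d))
                 (m≤m+n (2 * (6 + d)) _)))
        where open +-*-Solver
      ... | 4 with 3 ≤? length (2-nbrs S v)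
      ...   | yes 3≤ = inj₁ (star 3 indep v∈S eq (s≤s (s≤s (s≤s z≤n))) 3≤)
      ...   | no  <3 = inj₂ (≤-trans (+-monoʳ-≤ 6 (s≤s⁻¹ (≰⇒> <3))) (m≤m+n 8 _))
      local {S} {v} indep v∈S | 5 with 4 ≤? length (2-nbrs S v)
      ...   | yes 4≤ = inj₁ (star 4 indep v∈S eq (s≤s (s≤s (s≤s (s≤s z≤n)))) 4≤)
      ...   | no  <4 = inj₂ (≤-trans (+-monoʳ-≤ 6 (≤-trans (s≤s⁻¹ (≰⇒> <4)) (n≤1+n 3))) (m≤m+n 10 _))

    colourable₃ : ∀ S → Colouring S
    colourable₃ = colour-all λ {S} v∈S →
      [ id , (λ indep → reducible-by-discharging 6 1 mad< v∈S _ _ (sym (∑-nbrs S (is2 S))) (local indep)) ]′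
        (independent S)

-- Colourings of the whole graph

⌈/⌉-upper : ∀ m d → m ≤ ⌈ m / suc d ⌉ * suc d
⌈/⌉-upper m d = +-cancelʳ-≤ d _ _ (begin
  m + d                                          ≡⟨ m≡m%n+[m/n]*n (m + d) (suc d) ⟩
  (m + d) % suc d + ⌈ m / suc d ⌉ * suc d        ≤⟨ +-monoˡ-≤ _ (s≤s⁻¹ (m%n<n (m + d) (suc d))) ⟩
  d + ⌈ m / suc d ⌉ * suc d                      ≡⟨ +-comm d _ ⟩
  ⌈ m / suc d ⌉ * suc d + d                      ∎)
  where open ≤-Reasoning

⌈/⌉-least : ∀ m d x → m ≤ x * suc d → ⌈ m / suc d ⌉ ≤ x
⌈/⌉-least m d x m≤ = s≤s⁻¹ (m<n*o⇒m/o<n (begin-strict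
  m + d              ≤⟨ +-monoˡ-≤ d m≤ ⟩
  x * suc d + d      <⟨ +-monoʳ-< (x * suc d) (n<1+n d) ⟩
  x * suc d + suc d  ≡⟨ +-comm (x * suc d) _ ⟩
  suc x * suc d      ∎))
  where open ≤-Reasoning

lookup-injective : ∀ {A : Set} {xs : List A} → Unique xs → ∀ {i j} → lookup xs i ≡ lookup xs j → i ≡ j
lookup-injective (_ ∷ _)  {zero}  {zero}  _  = refl
lookup-injective (x∉ ∷ _) {zero}  {suc j} eq = contradiction eq (All.lookup x∉ (∈-lookup j))
lookup-injective (x∉ ∷ _) {suc i} {zero}  eq = contradiction (sym eq) (All.lookup x∉ (∈-lookup i))
lookup-injective (_ ∷ u)  {suc i} {suc j} eq = cong suc (lookup-injective u eq)

length-filter-lookup : ∀ {A : Set} {P : Pred A 0ℓ} (P? : Decidable P) xs →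
  length (filter (P? ∘ lookup xs) (allFin (length xs))) ≡ length (filter P? xs)
length-filter-lookup P? xs = begin
  length (filter (P? ∘ lookup xs) (List.tabulate id))   ≡⟨ length-filter-tabulate (P? ∘ lookup xs) id ⟩
  size (fromPred (P? ∘ lookup xs))                      ≡⟨ length-filter-tabulate P? (lookup xs) ⟨
  length (filter P? (List.tabulate (lookup xs)))        ≡⟨ cong (length ∘ filter P?) (tabulate-lookup xs) ⟩
  length (filter P? xs)                                 ∎
  where open ≡-Reasoning

length≤fibres : ∀ {A : Set} (f : A → ℕ) t as xs → (∀ {x} → x ∈ xs → f x ∈ as) →
  (∀ a → length (fibre f a xs) ≤ t) → length xs ≤ length as * t
length≤fibres f t []       []       cover small = z≤n
length≤fibres f t []       (x ∷ xs) cover small = contradiction (cover (here refl)) λ ()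
length≤fibres f t (a ∷ as) xs       cover small = begin
  length xs                               ≡⟨ length-filter+filter-∁ (λ x → f x ℕ.≟ a) xs ⟨
  length (fibre f a xs) + length rest     ≤⟨ +-mono-≤ (small a) (length≤fibres f t as rest cover′
                                               λ b → ≤-trans (fibre-rest b) (small b)) ⟩
  t + length as * t                       ∎
  where
  open ≤-Reasoning
  rest = filter (λ x → ¬? (f x ℕ.≟ a)) xs
  cover′ : ∀ {x} → x ∈ rest → f x ∈ as
  cover′ x∈ with x∈xs , fx≢a ← ∈-filter⁻ (λ x → ¬? (f x ℕ.≟ a)) {xs = xs} x∈ with cover x∈xs
  ... | here fx≡a = contradiction fx≡a fx≢a
  ... | there fx∈ = fx∈
  fibre-rest : ∀ b → length (fibre f b rest) ≤ length (fibre f b xs)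
  fibre-rest b with a ℕ.≟ b
  ... | yes refl = ≤-trans (≤-reflexive (cong length (filter-none (λ x → f x ℕ.≟ a) {xs = rest}
    (All.tabulate λ x∈ → proj₂ (∈-filter⁻ (λ x → ¬? (f x ℕ.≟ a)) {xs = xs} x∈))))) z≤n
  ... | no a≢b = ≤-reflexive (cong length (filter-absorb (λ x → f x ℕ.≟ b) (λ x → ¬? (f x ℕ.≟ a))
    (λ { refl fx≡a → a≢b (sym fx≡a) }) xs))

-- Equivalence of the two notions of forested colouring, and the lower bound

module Characterisation {n : ℕ} (G : Graph n) (t : ℕ) where

  open Graph G
  open InducedSubgraphs G

  inClasses? : ∀ (c : Fin n → ℕ) a b → Decidable (λ v → c v ≡ a ⊎ c v ≡ b)
  inClasses? c a b v = (c v ℕ.≟ a) ⊎-dec (c v ℕ.≟ b)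

  classes : (Fin n → ℕ) → ℕ → ℕ → List (Fin n)
  classes = twoClasses (suc t) G

  ∈-classes⁺ : ∀ {c a b v} → c v ≡ a ⊎ c v ≡ b → v ∈ classes c a b
  ∈-classes⁺ {c} {a} {b} p = ∈-filter⁺ (inClasses? c a b) (∈-allFin _) p

  ∈-classes⁻ : ∀ {c a b v} → v ∈ classes c a b → c v ≡ a ⊎ c v ≡ b
  ∈-classes⁻ {c} {a} {b} v∈ = proj₂ (∈-filter⁻ (inClasses? c a b) {xs = allFin n} v∈)

  classes-unique : ∀ c a b → Unique (classes c a b)
  classes-unique c a b = Unique.filter⁺ (inClasses? c a b) (Unique.allFin⁺ n)

  forested⇒isForested : ∀ {c} → Forested t ⊤ c → IsForested (suc t) G c
  forested⇒isForested {c} good = (λ u~v → proper ∈⊤ ∈⊤ u~v) , λ a b a≢b → forest a b , low-degree a b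
    where
    open Forested good
    forest : ∀ a b → Forest (induced G (classes c a b))
    forest a b C = acyclic (record
      { vertex = lookup (classes c a b) ∘ vertex
      ; injective = injective ∘ lookup-injective (classes-unique c a b)
      ; step = step ; close = close } , a , b , λ i → ∈⊤ , ∈-classes⁻ (∈-lookup (vertex i)))
      where open Cycle C
    other : ∀ a b {v} → v ∈ classes c a b →
      ∃[ d ] (∀ {x} → x ∈ classes c a b → v ~ x → c x ≡ d)
    other a b v∈ with ∈-classes⁻ {c} v∈
    ... | inj₁ refl = b , λ x∈ v~x → [ (λ eq → contradiction (sym eq) (proper ∈⊤ ∈⊤ v~x)) , id ]′ (∈-classes⁻ {c} x∈)
    ... | inj₂ refl = a , λ x∈ v~x → [ id , (λ eq → contradiction (sym eq) (proper ∈⊤ ∈⊤ v~x)) ]′ (∈-classes⁻ {c} x∈)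
    degree≤ : ∀ a b i → degree (induced G (classes c a b)) i ≤ t
    degree≤ a b i = ≤-trans (≤-reflexive (length-filter-lookup (v ~?_) (classes c a b)))
      (≤-trans (unique-⊆⇒length-≤ (Unique.filter⁺ (v ~?_) (classes-unique c a b)) λ x∈ →
         let x∈C , v~x = ∈-filter⁻ (v ~?_) {xs = classes c a b} x∈
         in ∈-fibre⁺ c ∈⊤ v~x (proj₂ (other a b v∈) x∈C v~x))
       (sparse ∈⊤ (proj₁ (other a b v∈))))
      where
      v = lookup (classes c a b) i
      v∈ : v ∈ classes c a b
      v∈ = ∈-lookup i
    low-degree : ∀ a b → maxDegree (induced G (classes c a b)) < suc t
    low-degree a b = s≤s (maxℕ≤v⁺ z≤n (All.tabulate bounded))
      where
      bounded : ∀ {d} → d ∈ map (degree (induced G (classes c a b))) (allFin _) → d ≤ t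
      bounded d∈ with i , _ , refl ← ∈-map⁻ _ d∈ = degree≤ a b i

  isForested⇒forested : ∀ {c} → IsForested (suc t) G c → Forested t ⊤ c
  isForested⇒forested {c} (proper , twoColoured) = record
    { proper = λ _ _ → proper ; sparse = λ _ → sparse ; acyclic = acyclic }
    where
    sparse : ∀ {v} a → length (fibre c a (nbrs ⊤ v)) ≤ t
    sparse {v} a with c v ℕ.≟ a
    ... | yes refl = ≤-trans (≤-reflexive (cong length (filter-none (λ x → c x ℕ.≟ c v) {xs = nbrs ⊤ v}
      (All.tabulate λ x∈ eq → proper (proj₂ (∈-nbrs⁻ x∈)) (sym eq))))) z≤n
    ... | no cv≢a = begin
      length (fibre c a (nbrs ⊤ v))                   ≤⟨ unique-⊆⇒length-≤ (fibre-unique c a ⊤ v) (λ x∈ →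
                                                           let _ , v~x , cx≡a = ∈-fibre⁻ c x∈
                                                           in ∈-filter⁺ (v ~?_) (∈-classes⁺ (inj₂ cx≡a)) v~x) ⟩
      length (filter (v ~?_) vs)                      ≡⟨ cong (λ u → length (filter (u ~?_) vs)) (lookup-index v∈) ⟩
      length (filter (lookup vs (Any.index v∈) ~?_) vs) ≡⟨ length-filter-lookup (lookup vs (Any.index v∈) ~?_) vs ⟨
      degree H (Any.index v∈)                         ≤⟨ All.lookup (xs≤maxℕ 0 (map (degree H) (allFin _))) (∈-map⁺ (degree H) (∈-allFin _)) ⟩
      maxDegree H                                     ≤⟨ s≤s⁻¹ (proj₂ (twoColoured (c v) a cv≢a)) ⟩
      t                                               ∎
      where
      open ≤-Reasoning
      vs = classes c (c v) a
      H  = induced G vs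
      v∈ : v ∈ vs
      v∈ = ∈-classes⁺ {c} (inj₁ refl)
    acyclic : ¬ BicolouredCycle ⊤ c
    acyclic (C , a , b , bi) with a ℕ.≟ b
    -- With `a` and `b` equal the cycle is monochromatic, and its first edge already violates
    -- properness.
    ... | yes refl = proper (step zero) (trans (reduce (proj₂ (bi zero))) (sym (reduce (proj₂ (bi (suc zero))))))
      where
      open Cycle C
      reduce : ∀ {x} → x ≡ a ⊎ x ≡ a → x ≡ a
      reduce = [ id , id ]′
    ... | no a≢b = proj₁ (twoColoured a b a≢b) record
      { vertex    = λ i → Any.index (vs∋ i)
      ; injective = λ {i} {j} eq → injective (trans (lookup-index (vs∋ i))
          (trans (cong (lookup (classes c a b)) eq) (sym (lookup-index (vs∋ j)))))
      ; step      = λ i → subst₂ _~_ (lookup-index (vs∋ (inject₁ i))) (lookup-index (vs∋ (suc i))) (step i)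
      ; close     = subst₂ _~_ (lookup-index (vs∋ (fromℕ _))) (lookup-index (vs∋ zero)) close
      }
      where
      open Cycle C
      vs∋ : ∀ i → vertex i ∈ classes c a b
      vs∋ i = ∈-classes⁺ {c} (proj₂ (bi i))

  -- With the list `0, ..., p` at every vertex, at most `p` colours occur around `v`, each at most
  -- `t` times.
  choosable⇒degree≤ : ∀ {q} → ForestedChoosable (suc t) G q → ∀ v → ∃[ p ] q ≡ suc p × degree G v ≤ p * t
  choosable⇒degree≤ {zero} choosable v =
    contradiction (proj₂ (proj₂ (choosable (λ _ → []) (λ _ → []) (λ _ → refl))) v) λ ()
  choosable⇒degree≤ {suc p} choosable v
    with c , isForested , listed ← choosable (λ _ → upTo (suc p)) (λ _ → Unique.upTo⁺ (suc p)) (λ _ → length-upTo (suc p))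
    = p , refl , (begin
    degree G v                  ≤⟨ unique-⊆⇒length-≤ (Unique.filter⁺ (v ~?_) (Unique.allFin⁺ n)) (λ x∈ →
                                     ∈-nbrs⁺ {⊤} ∈⊤ (proj₂ (∈-filter⁻ (v ~?_) {xs = allFin n} x∈))) ⟩
    length (nbrs ⊤ v)           ≤⟨ length≤fibres c t others (nbrs ⊤ v)
                                     (λ {x} x∈ → ∈-filter⁺ (λ a → ¬? (a ℕ.≟ c v)) (listed x)
                                       (proper ∈⊤ ∈⊤ (~-sym (proj₂ (∈-nbrs⁻ x∈)))))
                                     (sparse ∈⊤) ⟩
    length others * t           ≤⟨ *-monoˡ-≤ t (s≤s⁻¹ (≤-trans
                                     (filter-notAll (λ a → ¬? (a ℕ.≟ c v)) (upTo (suc p)) (Any.map (λ eq ne → ne (sym eq)) (listed v)))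
                                     (≤-reflexive (length-upTo (suc p))))) ⟩
    p * t                       ∎)
    where
    open ≤-Reasoning
    open Forested (isForested⇒forested isForested)
    others = filter (λ a → ¬? (a ℕ.≟ c v)) (upTo (suc p))

-- The functions are built value by value and match a given one only pointwise, so `P` has to
-- respect `≗`.
search : ∀ {n} {A : Set} (as : Fin n → List A) {P : (Fin n → A) → Set} → (∀ f → Dec (P f)) →
  (∀ {f g} → f ≗ g → P f → P g) → Dec (∃[ f ] (∀ i → f i ∈ as i) × P f)
search {zero} as {P} P? resp = map′ (λ p → Vector.[] , (λ ()) , p) (λ (f , _ , p) → resp (λ ()) p) (P? Vector.[])
search {suc n} as {P} P? resp = map′ cons split
  (any? (λ a → search (as ∘ suc) {λ f → P (a Vector.∷ f)} (λ f → P? (a Vector.∷ f))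
    λ f≗g → resp λ { zero → refl ; (suc i) → f≗g i }) (as zero))
  where
  cons : Any (λ a → ∃[ f ] (∀ i → f i ∈ as (suc i)) × P (a Vector.∷ f)) (as zero) →
    ∃[ f ] (∀ i → f i ∈ as i) × P f
  cons found with a , a∈ , f , f∈ , p ← find found =
    a Vector.∷ f , (λ { zero → a∈ ; (suc i) → f∈ i }) , p
  split : ∃[ f ] (∀ i → f i ∈ as i) × P f →
    Any (λ a → ∃[ f ] (∀ i → f i ∈ as (suc i)) × P (a Vector.∷ f)) (as zero)
  split (f , f∈ , p) = Any.map
    (λ { refl → f ∘ suc , f∈ ∘ suc , resp (λ { zero → refl ; (suc i) → refl }) p }) (f∈ zero)

-- Deciding choosability

lists : ∀ {A : Set} → ℕ → List A → List (List A)
lists zero    xs = [] ∷ []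
lists (suc m) xs = cartesianProductWith _∷_ xs (lists m xs)

∈-lists⁺ : ∀ {A : Set} {xs : List A} ys → (∀ {y} → y ∈ ys → y ∈ xs) → ys ∈ lists (length ys) xs
∈-lists⁺ []       _     = here refl
∈-lists⁺ (y ∷ ys) ys⊆xs = ∈-cartesianProductWith⁺ _∷_ (ys⊆xs (here refl)) (∈-lists⁺ ys (ys⊆xs ∘ there))

∈-lists⁻ : ∀ {A : Set} m {xs : List A} {ys} → ys ∈ lists m xs → length ys ≡ m
∈-lists⁻ zero (here refl) = refl
∈-lists⁻ (suc m) {xs} ys∈ with _ , _ , _ , ys′∈ , refl ← ∈-cartesianProductWith⁻ _∷_ xs (lists m xs) ys∈ =
  cong suc (∈-lists⁻ m ys′∈)

unique-map : ∀ {A B : Set} (f : A → B) {xs} →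
  (∀ {x y} → x ∈ xs → y ∈ xs → f x ≡ f y → x ≡ y) → Unique xs → Unique (map f xs)
unique-map f inj []       = []
unique-map f inj (x∉ ∷ u) =
  All.tabulate (λ y∈ eq → let z , z∈ , y≡ = ∈-map⁻ f y∈ in
    All.lookup x∉ z∈ (inj (here refl) (there z∈) (trans eq y≡)))
  ∷ unique-map f (λ x∈ y∈ → inj (there x∈) (there y∈)) u

position : List ℕ → ℕ → ℕ
position []       a = 0
position (x ∷ xs) a with a ℕ.≟ x
... | yes _ = 0
... | no  _ = suc (position xs a)

entry : List ℕ → ℕ → ℕ
entry []       _       = 0
entry (x ∷ xs) zero    = x
entry (x ∷ xs) (suc i) = entry xs i

entry-position : ∀ {xs a} → a ∈ xs → entry xs (position xs a) ≡ a
entry-position {x ∷ xs} {a} a∈ with a ℕ.≟ x | a∈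
... | yes refl | _          = refl
... | no  a≢x  | here a≡x   = contradiction a≡x a≢x
... | no  _    | there a∈xs = entry-position a∈xs

position< : ∀ {xs a} → a ∈ xs → position xs a < length xs
position< {x ∷ xs} {a} a∈ with a ℕ.≟ x | a∈
... | yes refl | _          = s≤s z≤n
... | no  a≢x  | here a≡x   = contradiction a≡x a≢x
... | no  _    | there a∈xs = s≤s (position< a∈xs)

-- A failed test at `m` raises the lower bound to `suc m`, and `j` bounds the number of tests.
least : ∀ {P : ℕ → Set} → (∀ q → Dec (P q)) → ∀ m j → P (m + j) → (∀ q → P q → m ≤ q) →
  ∃[ χ ] (P χ × (∀ q → P q → χ ≤ q)) × χ ≤ m + j
least P? m zero p lower rewrite +-identityʳ m = m , (p , lower) , ≤-refl
least {P} P? m (suc j) p lower with P? m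
... | yes pm = m , (pm , lower) , m≤m+n m (suc j)
... | no ¬pm with χ , minimal , χ≤ ← least {P} P? (suc m) j (subst P (+-suc m j) p)
                 (λ q pq → ≤∧≢⇒< (lower q pq) λ { refl → ¬pm pq }) =
  χ , minimal , ≤-trans χ≤ (≤-reflexive (sym (+-suc m j)))

module Decidability {n : ℕ} (G : Graph n) (t : ℕ) where

  open Graph G
  open InducedSubgraphs G
  open Characterisation G t

  -- The two colours are read off the first two vertices, which avoids a quantifier over all
  -- colours.
  AlternatingCycle : (Fin n → ℕ) → Set
  AlternatingCycle c = Σ[ C ∈ Cycle G ]
    (∀ i → c (Cycle.vertex C i) ≡ c (Cycle.vertex C zero) ⊎ c (Cycle.vertex C i) ≡ c (Cycle.vertex C (suc zero)))

  -- Equivalent to Forested t ⊤ c, but refers only to colours that occur.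
  record Coloured (c : Fin n → ℕ) : Set where
    field
      proper  : ∀ u v → u ~ v → c u ≢ c v
      sparse  : ∀ v u → length (fibre c (c u) (nbrs ⊤ v)) ≤ t
      acyclic : ¬ AlternatingCycle c

  coloured⇒forested : ∀ {c} → Coloured c → Forested t ⊤ c
  coloured⇒forested {c} good = record
    { proper = λ _ _ → proper _ _ ; sparse = λ _ → sparse′ ; acyclic = acyclic′ }
    where
    open Coloured good
    sparse′ : ∀ {v} a → length (fibre c a (nbrs ⊤ v)) ≤ t
    sparse′ {v} a with fibre c a (nbrs ⊤ v) in eq
    ... | []     = z≤n
    ... | x ∷ xs with _ , _ , refl ← ∈-fibre⁻ c (subst (x ∈_) (sym eq) (here refl)) =
      subst (λ l → length l ≤ t) eq (sparse v x)
    acyclic′ : ¬ BicolouredCycle ⊤ c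
    acyclic′ (C , a , b , bi) = acyclic (C , alternating)
      where
      open Cycle C
      alternating : ∀ i → c (vertex i) ≡ c (vertex zero) ⊎ c (vertex i) ≡ c (vertex (suc zero))
      alternating i with c (vertex i) ℕ.≟ c (vertex (suc zero))
      ... | yes eq = inj₂ eq
      ... | no ne  = inj₁ (alternate (proj₂ (bi i)) (proj₂ (bi (suc zero))) (proj₂ (bi zero))
                             ne (≢-sym (proper _ _ (step zero))))

  forested⇒coloured : ∀ {c} → Forested t ⊤ c → Coloured c
  forested⇒coloured {c} good = record
    { proper  = λ _ _ → proper ∈⊤ ∈⊤
    ; sparse  = λ _ _ → sparse ∈⊤ _
    ; acyclic = λ (C , alternating) → acyclic (C , _ , _ , λ i → ∈⊤ , alternating i) }
    where open Forested good

  -- All three conditions only forbid coincidences of colours, so they pass to any colouring with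
  -- fewer coincidences.
  refine : ∀ {c c′} → (∀ u v → c u ≡ c v → c′ u ≡ c′ v) → Coloured c′ → Coloured c
  refine {c} {c′} finer good = record
    { proper  = λ u v u~v eq → proper u v u~v (finer u v eq)
    ; sparse  = λ v u → ≤-trans (unique-⊆⇒length-≤ (fibre-unique c (c u) ⊤ v) λ {x} x∈ →
        let _ , v~x , eq = ∈-fibre⁻ c x∈ in ∈-fibre⁺ c′ ∈⊤ v~x (finer x u eq)) (sparse v u)
    ; acyclic = λ (C , alternating) → acyclic (C , λ i →
        [ inj₁ ∘ finer _ _ , inj₂ ∘ finer _ _ ]′ (alternating i)) }
    where open Coloured good

  coloured-resp : ∀ {c c′} → c ≗ c′ → Coloured c → Coloured c′
  coloured-resp c≗c′ = refine λ u v eq → trans (c≗c′ u) (trans eq (sym (c≗c′ v)))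

  alternatingCycle? : ∀ c → Dec (AlternatingCycle c)
  -- By injectivity `3 + m ≤ n`, so finitely many lengths are to be searched.
  alternatingCycle? c = map′ from to (Fin.any? λ (j : Fin n) →
    search {3 + toℕ j} (λ _ → allFin n) {IsAlternating} isAlternating? alternating-resp)
    where
    IsAlternating : ∀ {m} → (Fin (3 + m) → Fin n) → Set
    IsAlternating {m} f = (∀ i j → f i ≡ f j → i ≡ j) × (∀ (i : Fin (2 + m)) → f (inject₁ i) ~ f (suc i)) ×
      (f (fromℕ (2 + m)) ~ f zero) × (∀ i → c (f i) ≡ c (f zero) ⊎ c (f i) ≡ c (f (suc zero)))
    isAlternating? : ∀ {m} f → Dec (IsAlternating {m} f)
    isAlternating? f =
      Fin.all? (λ i → Fin.all? λ j → (f i Fin.≟ f j) →-dec (i Fin.≟ j)) ×-dec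
      Fin.all? (λ i → f (inject₁ i) ~? f (suc i)) ×-dec
      (f (fromℕ _) ~? f zero) ×-dec
      Fin.all? (λ i → (c (f i) ℕ.≟ c (f zero)) ⊎-dec (c (f i) ℕ.≟ c (f (suc zero))))
    alternating-resp : ∀ {m} {f g : Fin (3 + m) → Fin n} → f ≗ g → IsAlternating f → IsAlternating g
    alternating-resp f≗g (inj , step , close , alt) =
      (λ i j eq → inj i j (trans (f≗g i) (trans eq (sym (f≗g j))))) ,
      (λ i → subst₂ _~_ (f≗g _) (f≗g _) (step i)) ,
      subst₂ _~_ (f≗g _) (f≗g _) close ,
      λ i → subst₂ (λ x y → c x ≡ c y ⊎ _) (f≗g i) (f≗g zero)
              (subst₂ (λ x y → _ ⊎ c x ≡ c y) (f≗g i) (f≗g (suc zero)) (alt i))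
    from : (∃[ j ] ∃[ f ] ((i : Fin (3 + toℕ {n} j)) → f i ∈ allFin n) × IsAlternating f) → AlternatingCycle c
    from (j , f , _ , inj , step , close , alt) = record
      { m = toℕ j ; vertex = f ; injective = inj _ _ ; step = step ; close = close } , alt
    to : AlternatingCycle c → ∃[ j ] ∃[ f ] ((i : Fin (3 + toℕ {n} j)) → f i ∈ allFin n) × IsAlternating f
    to (C , alt) = fromℕ< m<n , found (Fin.toℕ-fromℕ< m<n)
      where
      open Cycle C
      m<n : m < n
      m<n = ≤-trans (s≤s (m≤n+m m 2)) (Fin.injective⇒≤ injective)
      found : ∀ {l} → l ≡ m → ∃[ f ] ((i : Fin (3 + l)) → f i ∈ allFin n) × IsAlternating f
      found refl = vertex , (λ i → ∈-allFin (vertex i)) , (λ _ _ → injective) , step , close , alt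

  coloured? : ∀ c → Dec (Coloured c)
  coloured? c = map′
    (λ (p , s , a) → record { proper = p ; sparse = s ; acyclic = a })
    (λ good → Coloured.proper good , Coloured.sparse good , Coloured.acyclic good)
    (Fin.all? (λ u → Fin.all? λ v → (u ~? v) →-dec ¬? (c u ℕ.≟ c v)) ×-dec
     Fin.all? (λ v → Fin.all? λ u → length (fibre c (c u) (nbrs ⊤ v)) ≤? t) ×-dec
     ¬? (alternatingCycle? c))

  forestedColorable? : ∀ L → Dec (ForestedColorable (suc t) G L)
  forestedColorable? L = map′
    (λ (c , c∈ , good) → c , forested⇒isForested (coloured⇒forested good) , c∈)
    (λ (c , good , c∈) → c , c∈ , forested⇒coloured (isForested⇒forested good))
    (search L coloured? coloured-resp)

  -- `f ∘ g` fixes every colour that `c` uses, so `g` merges no two classes of `c`.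
  rename : ∀ (L : Fin n → List ℕ) (f g : ℕ → ℕ) → (∀ {v a} → a ∈ L v → g (f a) ≡ a) →
    ForestedColorable (suc t) G (map f ∘ L) → ForestedColorable (suc t) G L
  rename L f g inverse (c , good , c∈) = g ∘ c ,
    forested⇒isForested (coloured⇒forested (refine finer (forested⇒coloured (isForested⇒forested good)))) ,
    λ v → let a , a∈ , eq = ∈-map⁻ f (c∈ v) in subst (_∈ L v) (sym (trans (cong g eq) (inverse a∈))) a∈
    where
    f∘g : ∀ v → f (g (c v)) ≡ c v
    f∘g v = let a , a∈ , eq = ∈-map⁻ f (c∈ v) in trans (cong (f ∘ g) eq) (trans (cong f (inverse a∈)) (sym eq))
    finer : ∀ u v → g (c u) ≡ g (c v) → c u ≡ c v
    finer u v eq = trans (sym (f∘g u)) (trans (cong f eq) (f∘g v))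

  -- Colours may be renamed, so lists of colours below n * q suffice.
  forestedChoosable? : ∀ q → Dec (ForestedChoosable (suc t) G q)
  forestedChoosable? q = map′ from to (¬? (search (λ _ → lists q (upTo (n * q))) bad? bad-resp))
    where
    Bad : (Fin n → List ℕ) → Set
    Bad L = (∀ v → Unique (L v)) × ¬ ForestedColorable (suc t) G L
    bad? : ∀ L → Dec (Bad L)
    bad? L = Fin.all? (λ v → unique? (L v)) ×-dec ¬? (forestedColorable? L)
    bad-resp : ∀ {L L′} → L ≗ L′ → Bad L → Bad L′
    bad-resp L≗L′ (unique , ¬colourable) = (λ v → subst Unique (L≗L′ v) (unique v)) ,
      λ (c , good , c∈) → ¬colourable (c , good , λ v → subst (c v ∈_) (sym (L≗L′ v)) (c∈ v))
    BadLists = ∃[ L ] (∀ v → L v ∈ lists q (upTo (n * q))) × Bad L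
    to : ForestedChoosable (suc t) G q → ¬ BadLists
    to choosable (L , L∈ , unique , ¬colourable) = ¬colourable (choosable L unique (∈-lists⁻ q ∘ L∈))
    from : ¬ BadLists → ForestedChoosable (suc t) G q
    -- A colour is renamed to its first position in the concatenation of all lists, which has length
    -- `n * q`.
    from none L unique len = rename L f g inverse (decidable-stable (forestedColorable? (map f ∘ L))
      λ ¬colourable → none (map f ∘ L , bounded , (λ v → unique-map f (injective v) (unique v)) , ¬colourable))
      where
      colours = concat (map L (allFin n))
      f = position colours
      g = entry colours
      ∈-colours : ∀ {v a} → a ∈ L v → a ∈ colours
      ∈-colours {v} a∈ = ∈-concat⁺′ a∈ (∈-map⁺ L (∈-allFin v))
      length-concat : ∀ vs → length (concat (map L vs)) ≡ length vs * q
      length-concat []       = refl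
      length-concat (v ∷ vs) = trans (length-++ (L v)) (cong₂ _+_ (len v) (length-concat vs))
      length-colours : length colours ≡ n * q
      length-colours = trans (length-concat (allFin n)) (cong (_* q) (length-tabulate {n = n} id))
      inverse : ∀ {v a} → a ∈ L v → g (f a) ≡ a
      inverse a∈ = entry-position (∈-colours a∈)
      injective : ∀ v {a b} → a ∈ L v → b ∈ L v → f a ≡ f b → a ≡ b
      injective v a∈ b∈ eq = trans (sym (inverse a∈)) (trans (cong g eq) (inverse b∈))
      bounded : ∀ v → map f (L v) ∈ lists q (upTo (n * q))
      bounded v = subst (λ l → map f (L v) ∈ lists l (upTo (n * q))) (trans (length-map f (L v)) (len v))
        (∈-lists⁺ (map f (L v)) λ y∈ → let a , a∈ , eq = ∈-map⁻ f y∈ in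
          ∈-upTo⁺ (subst₂ _<_ (sym eq) length-colours (position< (∈-colours a∈))))

-- The bounds on the choice number for `k = t + 1`

open import Data.Integer.Base using (+_)

theorem1p3 : ∀ (k : ℕ) → k ≥ 4 → ∀ {n : ℕ} (G : Graph n) → maxDegree G ≥ k →
    (mad G ℚ.< (+ 12) ℚ./ 5 →
    IsForestedChoiceNumber k G (⌈ maxDegree G / (k ∸ 1) ⌉ + 1))
    × (mad G ℚ.< (+ 8) ℚ./ 3 →
    ∃[ χ ] (IsForestedChoiceNumber k G χ × χ ≤ ⌈ maxDegree G / (k ∸ 1) ⌉ + 2))
    × (mad G ℚ.< (+ 3) ℚ./ 1 →
    ∃[ χ ] (IsForestedChoiceNumber k G χ × χ ≤ ⌈ maxDegree G / (k ∸ 1) ⌉ + 3))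
theorem1p3 (suc t@(suc t′)) (s≤s 3≤t) {n} G k≤Δ =
  (λ mad< → choosable₁ mad< , lower) ,
  (λ mad< → at-most 1 (choosable₂ mad<)) ,
  (λ mad< → at-most 2 (choosable₃ mad<))
  where
  open InducedSubgraphs G
  open Sparse G
  open Characterisation G t
  open Decidability G t
  M = ⌈ maxDegree G / t ⌉

  Δ≤ : maxDegree G ≤ M * t
  Δ≤ = ⌈/⌉-upper (maxDegree G) t′

  -- From `t < k ≤ Δ ≤ M * t`.
  2≤M : 2 ≤ M
  2≤M = *-cancelʳ-< t 1 M (≤-trans (≤-trans (s≤s (≤-reflexive (*-identityˡ t))) k≤Δ) Δ≤)

  bounded : ∀ S v → deg S v ≤ M * t
  bounded S v = ≤-trans (deg≤maxDegree S v) Δ≤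

  choosable₁ : mad G ℚ.< (+ 12) ℚ./ 5 → ForestedChoosable (suc t) G (M + 1)
  choosable₁ mad< L unique len =
    let c , good , listed = Discharging.colourable₁ G t M 3≤t 2≤M bounded L unique mad< len ⊤
    in c , forested⇒isForested good , λ v → listed ∈⊤

  choosable₂ : mad G ℚ.< (+ 8) ℚ./ 3 → ForestedChoosable (suc t) G (M + 2)
  choosable₂ mad< L unique len =
    let c , good , listed = Discharging.colourable₂ G t M 3≤t 2≤M bounded L unique mad< len ⊤
    in c , forested⇒isForested good , λ v → listed ∈⊤

  choosable₃ : mad G ℚ.< (+ 3) ℚ./ 1 → ForestedChoosable (suc t) G (M + 3)
  choosable₃ mad< L unique len =
    let c , good , listed = Discharging.colourable₃ G t M 3≤t 2≤M bounded L unique mad< len ⊤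
    in c , forested⇒isForested good , λ v → listed ∈⊤

  -- The maximum is either the default 0, excluded by `k ≤ Δ`, or the degree of a vertex.
  attained : ∃[ v ] degree G v ≡ maxDegree G
  attained with argmax-sel id 0 (map (degree G) (allFin n))
  ... | inj₁ Δ≡0 = contradiction (≤-trans k≤Δ (≤-reflexive Δ≡0)) λ ()
  ... | inj₂ Δ∈ with v , _ , eq ← ∈-map⁻ (degree G) Δ∈ = v , sym eq

  lower : ∀ q → ForestedChoosable (suc t) G q → M + 1 ≤ q
  lower q choosable with v , deg≡Δ ← attained with p , refl , deg≤ ← choosable⇒degree≤ choosable v =
    ≤-trans (≤-reflexive (+-comm M 1))
      (s≤s (⌈/⌉-least (maxDegree G) t′ p (subst (_≤ p * t) deg≡Δ deg≤)))

  -- The lower bound `M + 1` holds without any bound on `mad G`, so the search for the choice number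
  -- starts there.
  at-most : ∀ j → ForestedChoosable (suc t) G (M + suc j) →
    ∃[ χ ] (IsForestedChoiceNumber (suc t) G χ × χ ≤ M + suc j)
  at-most j choosable = subst (λ b → ∃[ χ ] (IsForestedChoiceNumber (suc t) G χ × χ ≤ b)) (+-assoc M 1 j)
    (least forestedChoosable? (M + 1) j (subst (ForestedChoosable (suc t) G) (sym (+-assoc M 1 j)) choosable) lower)
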